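{- Let $n \geq 6$ and let $F \subseteq \mathbb{N}$ be an arbitrary finite set such that either $F = \emptyset$ or $\min F \geq 3$. Then $Q_{U(F,n)} \geq \frac{5}{4}$. In particular, $Q_{R(n)} \geq \frac{5}{4}$ for every $n \geq 6$.
   Context: For a nonzero integer $N$, $\mathrm{rad}(N)$ denotes the largest square-free positive divisor of $N$. For $a = (a_1,\ldots,a_n) \in \mathbb{Z}^n$ with all $a_i \neq 0$, the quality of $a$ is $q(a) = \frac{\log(\max\{|a_1|,\ldots,|a_n|\})}{\log \mathrm{rad}(a_1 \cdots a_n)}$. For a set $A$ of such $n$-tuples, $Q_A$ denotes the limit superior of $q(a)$ over $a \in A$ (i.e. $\inf_{S \subseteq A \text{ finite}} \sup_{a \in A \setminus S} q(a)$). For $n \geq 3$ and a finite set $F \subseteq \mathbb{N}$ (with $\min F \geq 3$ if $F \neq \emptyset$), $U(F,n)$ is the set of all $(a_1,\ldots,a_n) \in \mathbb{Z}^n$ such that: (i) $\gcd(a_i,a_j) = 1$ for all $1 \leq i < j \leq n$; (ii) $a_1 + \cdots + a_n = 0$; (iii) there are no $b_1,\ldots,b_n \in \{ -1,0,1\}$ and indices $i,j$ with $b_i = 0$, $b_j = 1$ and $\sum_{k=1}^n b_k a_k = 0$; (iv) none of $a_1,\ldots,a_n$ is a multiple of any element of $F$. $R(n)$ is the set of all $(a_1,\ldots,a_n) \in \mathbb{Z}^n$ such that: $a_1 + \cdots + a_n = 0$; there are no $b_1,\ldots,b_n \in \{0,1\}$ and indices $i,j$ with $b_i = 0$, $b_j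 = 1$ and $\sum_{k=1}^n b_k a_k = 0$; and $\gcd(a_i,a_j) = 1$ for all $1 \leq i < j \leq n$. -}

module Defs where

open import Data.Nat as ℕ using (ℕ; zero; suc; _^_; _<_; _≤_; _⊔_)
open import Data.Nat.Divisibility using (_∣_; _∣?_)
open import Data.Nat.Primality using (Prime; prime?)
open import Data.Nat.GCD using (gcd)
open import Data.Integer as ℤ using (ℤ; ∣_∣; 0ℤ; 1ℤ; -1ℤ)
open import Data.Fin as Fin using (Fin)
open import Data.Vec using (Vec; lookup; tail)
open import Data.List using (List; filter; upTo)
open import Data.Nat.ListAction using (product)
open import Data.List.Relation.Unary.All using (All)
open import Data.List.Membership.Propositional using (_∈_)
open import Data.Product using (Σ; ∃; _×_; _,_)
open import Data.Sum using (_⊎_)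
open import Relation.Nullary using (¬_)
open import Relation.Nullary.Decidable using (_×-dec_)
open import Relation.Binary.PropositionalEquality using (_≡_)

rad : ℕ → ℕ
rad N = product (filter (λ p → prime? p ×-dec p ∣? N) (upTo (suc N)))

sumℤ : ∀ {n} → (Fin n → ℤ) → ℤ
sumℤ {zero}  f = 0ℤ
sumℤ {suc n} f = f Fin.zero ℤ.+ sumℤ (λ i → f (Fin.suc i))

prodℤ : ∀ {n} → (Fin n → ℤ) → ℤ
prodℤ {zero}  f = 1ℤ
prodℤ {suc n} f = f Fin.zero ℤ.* prodℤ (λ i → f (Fin.suc i))

maxAbs : ∀ {n} → Vec ℤ n → ℕ
maxAbs {zero}  a = 0
maxAbs {suc n} a = ∣ lookup a Fin.zero ∣ ⊔ maxAbs (tail a)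

radProd : ∀ {n} → Vec ℤ n → ℕ
radProd a = rad ∣ prodℤ (lookup a) ∣

-- "q(a) > p/d" for d > 0.  Since q(a) = log max|a_i| / log rad(a_1⋯a_n),
-- and rad(a_1⋯a_n) ≥ 2 for all tuples considered, this is equivalent to
-- rad(a_1⋯a_n)^p < (max|a_i|)^d.
QualityAbove : ∀ {n} → Vec ℤ n → ℕ → ℕ → Set
QualityAbove a p d = radProd a ^ p < maxAbs a ^ d

PairwiseCoprime : ∀ {n} → Vec ℤ n → Set
PairwiseCoprime {n} a = ∀ (i j : Fin n) → i Fin.< j → gcd ∣ lookup a i ∣ ∣ lookup a j ∣ ≡ 1

SumZero : ∀ {n} → Vec ℤ n → Set
SumZero a = sumℤ (lookup a) ≡ 0ℤ

VanishingSubsum : ∀ {n} → (ℤ → Set) → Vec ℤ n → Set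
VanishingSubsum {n} Allowed a =
  Σ (Fin n → ℤ) λ b → (∀ k → Allowed (b k)) ×
    (∃ λ i → b i ≡ 0ℤ) × (∃ λ j → b j ≡ 1ℤ) ×
    (sumℤ (λ k → b k ℤ.* lookup a k) ≡ 0ℤ)

InMinusZeroOne : ℤ → Set
InMinusZeroOne x = x ≡ -1ℤ ⊎ x ≡ 0ℤ ⊎ x ≡ 1ℤ

InZeroOne : ℤ → Set
InZeroOne x = x ≡ 0ℤ ⊎ x ≡ 1ℤ

InU : (F : List ℕ) (n : ℕ) → Vec ℤ n → Set
InU F n a =
  PairwiseCoprime a × SumZero a × ¬ VanishingSubsum InMinusZeroOne a ×
  (∀ (f : ℕ) → f ∈ F → ∀ (i : Fin n) → ¬ (f ∣ ∣ lookup a i ∣))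

InR : (n : ℕ) → Vec ℤ n → Set
InR n a = SumZero a × ¬ VanishingSubsum InZeroOne a × PairwiseCoprime a

-- Q_A ≥ 5/4, where A is given by the predicate P on Vec ℤ n:
-- for every rational p/d < 5/4 and every finite S ⊆ A, some a ∈ A ∖ S has q(a) > p/d.
-- (Negative thresholds are implied by the threshold 0.)
QualityLimsupAtLeast5/4 : ∀ {n} → (Vec ℤ n → Set) → Set
QualityLimsupAtLeast5/4 {n} P =
  ∀ (p d : ℕ) → 0 < d → 4 ℕ.* p < 5 ℕ.* d → (S : List (Vec ℤ n)) →
  Σ (Vec ℤ n) λ a → P a × ¬ (a ∈ S) × QualityAbove a p d

{-# OPTIONS --safe #-}
-- For every t and x,
--   (x + t)⁵ − (x − t)⁵ + (x² − 10t³)² − (10t + 1)x⁴ = 2t⁵ + 100t⁶.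
-- Fix t divisible by all elements of F and by a suitable constant, and let x run through the
-- powers of a number p ≡ 1 modulo everything in sight. The four large terms then have a radical
-- of order at most x⁴ while the maximum is of order x⁵, and the right-hand side is a constant that can
-- be written as minus a sum of n − 4 fixed summands. All terms are units modulo t (one summand 2 is
-- needed for odd n), so F causes no obstruction. Reading a vanishing signed sum as an expansion in
-- base x shows that all its coefficients agree.
module Submission where

open import Defs
open import Data.Nat as ℕ using (ℕ; zero; suc; s≤s; z≤n; _≤_)
import Data.Nat.Coprimality as ℕ
import Data.Nat.Divisibility as ℕ
import Data.Nat.Properties as ℕ
import Data.Nat.Tactic.RingSolver as ℕ
open import Data.Nat.GCD using (gcd)
open import Data.Nat.ListAction using (product)
open import Data.Nat.ListAction.Properties using (product≢0; ∈⇒∣product)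
open import Data.Nat.Primality using (Prime; prime?; euclidsLemma; ¬prime[1])
open import Data.Nat.Primality.Factorisation using (factorisationHasAllPrimeFactors)
open import Data.Integer using (ℤ; +_; 0ℤ; 1ℤ; -1ℤ; ∣_∣; _+_; _*_; _-_; -_; ≢-nonZero)
import Data.Integer.Properties as ℤ
open import Data.Integer.Divisibility.Signed
  using (_∣_; divides; ∣⇒∣ᵤ; ∣ᵤ⇒∣; ∣-refl; ∣-trans; ∣m⇒∣m*n; ∣n⇒∣m*n; ∣m∣n⇒∣m+n; ∣m⇒∣-m; 0∣⇒≡0)
open import Data.Integer.Tactic.RingSolver using (solve-∀)
open import Data.Fin as Fin using (Fin)
open import Data.List using (List; []; _∷_; filter; upTo)
open import Data.List.Membership.Propositional using (_∈_)
open import Data.List.Relation.Unary.All as All using (All; []; _∷_)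
import Data.List.Relation.Unary.All.Properties as All
open import Data.List.Relation.Unary.AllPairs using ([]; _∷_)
open import Data.List.Relation.Unary.Any using (here; there)
open import Data.List.Relation.Unary.Unique.Propositional using (Unique)
import Data.List.Relation.Unary.Unique.Propositional.Properties as Unique
open import Data.Vec using (Vec; []; _∷_; lookup)
open import Data.Vec.Relation.Unary.All as Allᵥ using ([]; _∷_) renaming (All to Allᵥ)
open import Data.Vec.Relation.Unary.All.Properties using (lookup⁺)
open import Data.Vec.Relation.Unary.AllPairs as AllPairs using (AllPairs; []; _∷_)
open import Data.Product using (∃; ∃₂; _×_; _,_; proj₁; proj₂)
open import Data.Sum using (_⊎_; inj₁; inj₂)
open import Function using (_∘_)
open import Relation.Nullary using (¬_; yes; no; contradiction)
open import Relation.Nullary.Decidable using (_×-dec_)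
open import Relation.Binary.PropositionalEquality

-- Coprimality by Bézout coefficients

-- The difference of fifth powers is `10tx⁴ + 20t³x² + 2t⁵`. The square cancels its `x²` term while
-- adding only `x² - 10t³` to the radical, and the `x⁴` terms gather in `(1 + 10t)x⁴`, whose
-- contribution stays bounded because powers of `p` have no primes beyond those of `p`. The obstacle
-- is pairwise coprimality. Setting `x = 1` modulo fixed numbers, or eliminating `x` between two
-- entries, turns each condition into one on polynomials in `t`; Bézout combinations reduce these to
-- constants, and `t` is a multiple of those constants. The choices are made in a fixed order: `t`
-- from `F`, the small summands from `t`, then `p` from both. Only the exponent of `p` depends on
-- the threshold and on the excluded finite set, so the constant in the radical bound is fixed while
-- `x` grows.

infix 4 _⊥_

-- Explicit coefficients turn coprimality into ring identities, stable under products and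
-- congruences; `gcd` is reached only through `⊥⇒gcd≡1`.
_⊥_ : ℤ → ℤ → Set
a ⊥ b = ∃₂ λ u v → u * a + v * b ≡ 1ℤ

⊥-sym : ∀ {a b} → a ⊥ b → b ⊥ a
⊥-sym {a} {b} (u , v , eq) = v , u , trans (ℤ.+-comm (v * b) (u * a)) eq

⊥-one : ∀ {a} → a ⊥ 1ℤ
⊥-one {a} = 0ℤ , 1ℤ , refl

-- The two Bézout relations are multiplied.
⊥-* : ∀ {a b c} → a ⊥ b → a ⊥ c → a ⊥ b * c
⊥-* {a} {b} {c} (u , v , p) (u′ , v′ , q) =
  u * u′ * a + u * v′ * c + v * b * u′ , v * v′ ,
  trans (rearrange a b c u v u′ v′) (cong₂ _*_ p q)
  where
  rearrange : ∀ a b c u v u′ v′ →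
    (u * u′ * a + u * v′ * c + v * b * u′) * a + v * v′ * (b * c) ≡
    (u * a + v * b) * (u′ * a + v′ * c)
  rearrange = solve-∀

⊥-neg : ∀ {a b} → a ⊥ b → a ⊥ - b
⊥-neg {a} {b} (u , v , eq) = u , - v , trans (cong (_+_ (u * a)) (neg-cancel v b)) eq
  where
  neg-cancel : ∀ v b → - v * - b ≡ v * b
  neg-cancel = solve-∀

⊥-∣ : ∀ {a b c} → c ∣ b → a ⊥ b → a ⊥ c
⊥-∣ {a} {b} {c} (divides q refl) (u , v , eq) = u , v * q ,
  trans (cong (_+_ (u * a)) (ℤ.*-assoc v q c)) eq

infix 4 _≡_[mod_]

_≡_[mod_] : ℤ → ℤ → ℤ → Set
a ≡ b [mod m ] = ∃ λ k → a ≡ b + k * m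

⊥-mod : ∀ {a b m} → a ≡ b [mod m ] → b ⊥ m → a ⊥ m
⊥-mod {b = b} {m} (k , refl) (u , v , eq) = u , v - u * k , trans (rearrange b m k u v) eq
  where
  rearrange : ∀ b m k u v → u * (b + k * m) + (v - u * k) * m ≡ u * b + v * m
  rearrange = solve-∀

-- A common divisor of `a` and `b` divides `c`. This is the elimination tool: for polynomials in `t`
-- the cofactors `α`, `β` are chosen to make `c` a constant dividing `t`.
⊥-combination : ∀ {a b c} α β → α * a + β * b ≡ c → a ⊥ c → a ⊥ b
⊥-combination {a} {b} α β refl (u , v , eq) = u + v * α , v * β , trans (rearrange a b α β u v) eq
  where
  rearrange : ∀ a b α β u v → (u + v * α) * a + v * β * b ≡ u * a + v * (α * a + β * b)
  rearrange = solve-∀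

1⊥ : ∀ {m} → 1ℤ ⊥ m
1⊥ = ⊥-sym ⊥-one

⊥⇒coprime : ∀ {a b} → a ⊥ b → ∀ {d} → d ℕ.∣ ∣ a ∣ → d ℕ.∣ ∣ b ∣ → d ≡ 1
⊥⇒coprime {a} {b} (u , v , eq) {d} d∣a d∣b = ℕ.∣1⇒≡1
  (∣⇒∣ᵤ {+ d} (subst (+ d ∣_) eq (∣m∣n⇒∣m+n (∣n⇒∣m*n u (∣ᵤ⇒∣ {+ d} d∣a)) (∣n⇒∣m*n v (∣ᵤ⇒∣ {+ d} d∣b)))))

⊥⇒gcd≡1 : ∀ {a b} → a ⊥ b → gcd ∣ a ∣ ∣ b ∣ ≡ 1
⊥⇒gcd≡1 a⊥b = ℕ.coprime⇒gcd≡1 λ (d∣a , d∣b) → ⊥⇒coprime a⊥b d∣a d∣b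

allPairs⇒pairwiseCoprime : ∀ {n} {a : Vec ℤ n} → AllPairs _⊥_ a → PairwiseCoprime a
allPairs⇒pairwiseCoprime (p ∷ _) Fin.zero (Fin.suc j) _ = ⊥⇒gcd≡1 (lookup⁺ p j)
allPairs⇒pairwiseCoprime (_ ∷ ps) (Fin.suc i) (Fin.suc j) (s≤s i<j) = allPairs⇒pairwiseCoprime ps i j i<j

-- Reading off the digits of an expansion in base m.
digit : ∀ m {c} q → c + m * q ≡ 0ℤ → ∣ c ∣ ℕ.< ∣ m ∣ → c ≡ 0ℤ × q ≡ 0ℤ
digit m {c} q eq c<m = c≡0 , q≡0
  where
  m∣c : ∣ m ∣ ℕ.∣ ∣ c ∣
  m∣c = ∣⇒∣ᵤ (divides (- q) (trans (isolate c (m * q)) (trans (cong (_- m * q) eq) (rearrange m q))))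
    where
    isolate : ∀ c n → c ≡ (c + n) - n
    isolate = solve-∀
    rearrange : ∀ m q → 0ℤ - m * q ≡ - q * m
    rearrange = solve-∀

  c≡0 : c ≡ 0ℤ
  c≡0 with c ℤ.≟ 0ℤ
  ... | yes c≡0 = c≡0
  ... | no c≢0 = contradiction (ℕ.∣⇒≤ {{≢-nonZero c≢0}} m∣c) (ℕ.<⇒≱ c<m)

  mq≡0 : m * q ≡ 0ℤ
  mq≡0 = trans (sym (ℤ.+-identityˡ (m * q))) (trans (cong (_+ m * q) (sym c≡0)) eq)

  q≡0 : q ≡ 0ℤ
  q≡0 with ℤ.i*j≡0⇒i≡0∨j≡0 m mq≡0
  ... | inj₂ q≡0 = q≡0
  ... | inj₁ refl = contradiction c<m ℕ.n≮0

-- Signed sums and rigidity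

sumAbs : ∀ {n} → Vec ℤ n → ℕ
sumAbs [] = 0
sumAbs (a ∷ as) = ∣ a ∣ ℕ.+ sumAbs as

∣signed*∣≤ : ∀ {b} → InMinusZeroOne b → ∀ a → ∣ b * a ∣ ℕ.≤ ∣ a ∣
∣signed*∣≤ (inj₁ refl) a = ℕ.≤-reflexive (trans (cong ∣_∣ (ℤ.-1*i≡-i a)) (ℤ.∣-i∣≡∣i∣ a))
∣signed*∣≤ (inj₂ (inj₁ refl)) a = z≤n
∣signed*∣≤ (inj₂ (inj₂ refl)) a = ℕ.≤-reflexive (cong ∣_∣ (ℤ.*-identityˡ a))

∣signedSum∣≤ : ∀ {n} (a : Vec ℤ n) {b : Fin n → ℤ} → (∀ i → InMinusZeroOne (b i)) →
  ∣ sumℤ (λ i → b i * lookup a i) ∣ ℕ.≤ sumAbs a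
∣signedSum∣≤ [] _ = z≤n
∣signedSum∣≤ (x ∷ a) {b} signed = ℕ.≤-trans (ℤ.∣i+j∣≤∣i∣+∣j∣ (b Fin.zero * x) _)
  (ℕ.+-mono-≤ (∣signed*∣≤ (signed Fin.zero) x) (∣signedSum∣≤ a (signed ∘ Fin.suc)))

∣signed-signed∣≤2 : ∀ {b c} → InMinusZeroOne b → InMinusZeroOne c → ∣ b - c ∣ ℕ.≤ 2
∣signed-signed∣≤2 {b} {c} sb sc = ℕ.≤-trans (ℤ.∣i-j∣≤∣i∣+∣j∣ b c) (ℕ.+-mono-≤ (∣signed∣≤1 sb) (∣signed∣≤1 sc))
  where
  ∣signed∣≤1 : ∀ {b} → InMinusZeroOne b → ∣ b ∣ ℕ.≤ 1
  ∣signed∣≤1 {b} sb = subst (ℕ._≤ 1) (cong ∣_∣ (ℤ.*-identityʳ b)) (∣signed*∣≤ sb 1ℤ)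

Rigid : ∀ {n} → Vec ℤ (suc n) → Set
Rigid {n} a = (b : Fin (suc n) → ℤ) → (∀ i → InMinusZeroOne (b i)) →
  sumℤ (λ i → b i * lookup a i) ≡ 0ℤ → ∀ i → b i ≡ b Fin.zero

rigid⇒¬vanishingSubsum : ∀ {n} {a : Vec ℤ (suc n)} → Rigid a → ¬ VanishingSubsum InMinusZeroOne a
rigid⇒¬vanishingSubsum rigid (b , signed , (i , bi≡0) , (j , bj≡1) , eq)
  with () ← trans (sym bi≡0) (trans (trans (rigid b signed eq i) (sym (rigid b signed eq j))) bj≡1)

∣prodℤ : ∀ {n} (a : Vec ℤ n) → Allᵥ (_∣ prodℤ (lookup a)) a
∣prodℤ [] = []
∣prodℤ (x ∷ a) = ∣m⇒∣m*n _ ∣-refl ∷ Allᵥ.map (∣n⇒∣m*n x) (∣prodℤ a)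

*≢0 : ∀ {i j} → i ≢ 0ℤ → j ≢ 0ℤ → i * j ≢ 0ℤ
*≢0 {i} i≢0 j≢0 ij≡0 with ℤ.i*j≡0⇒i≡0∨j≡0 i ij≡0
... | inj₁ i≡0 = i≢0 i≡0
... | inj₂ j≡0 = j≢0 j≡0

prodℤ≢0 : ∀ {n} {a : Vec ℤ n} → Allᵥ (_≢ 0ℤ) a → prodℤ (lookup a) ≢ 0ℤ
prodℤ≢0 [] ()
prodℤ≢0 (x≢0 ∷ a≢0) = *≢0 x≢0 (prodℤ≢0 a≢0)

-- Lets one number `P * + H` meet prescribed divisibilities, through `P`, and a size bound, through
-- `H`.
≤∣*∣ : ∀ {P} → P ≢ 0ℤ → ∀ H → H ℕ.≤ ∣ P * + H ∣
≤∣*∣ {P} P≢0 H = subst (H ℕ.≤_) (sym (ℤ.abs-* P (+ H))) (ℕ.m≤n*m H (∣ P ∣) {{≢-nonZero P≢0}})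

mod-shift : ∀ a {m n} → m ∣ n → a + n ≡ a [mod m ]
mod-shift a (divides q eq) = q , cong (_+_ a) eq




-- If `a` were zero, 2 would divide both. Units modulo `t` are thus nonzero at no extra cost.
⊥even⇒≢0 : ∀ {a t} → + 2 ∣ t → a ⊥ t → a ≢ 0ℤ
⊥even⇒≢0 2∣t a⊥t refl with () ← ⊥⇒coprime (⊥-∣ 2∣t a⊥t) {2} (ℕ.divides 0 refl) ℕ.∣-refl

-- Small summands

-1⊥ : ∀ {m} → -1ℤ ⊥ m
-1⊥ = ⊥-sym (⊥-neg ⊥-one)

-- M collects the residues of the large summands modulo a small summand, for x ≡ 1, so being
-- coprime to M makes the small summands coprime to the large ones. The head is the summand that can be split further.
record Completion (K t M : ℤ) (n : ℕ) : Set where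
  field
    head : ℤ
    tail : Vec ℤ n
    head⊥t : head ⊥ t
    -- Splitting uses a nonzero multiple of `head - 1ℤ`.
    head≢1 : head ≢ 1ℤ
    total : sumℤ (lookup (K ∷ head ∷ tail)) ≡ 0ℤ
    pairwise : AllPairs _⊥_ (head ∷ tail)
    nondegenerate : Allᵥ (_⊥ M) (head ∷ tail)
    -- The exception 2 is harmless for `F`, whose elements are at least 3, and is confined to the
    -- tail so that the head to be split stays a unit modulo `t`.
    admissible : Allᵥ (λ e → e ⊥ t ⊎ e ≡ + 2) tail
    rigid : Rigid (K ∷ head ∷ tail)

-- The heads start from `- (K + 1ℤ)`, hence `K+1⊥M`; 4 bounds the digits met in base `K`, the worst
-- case being `three`.
module Completions {K t M : ℤ} (2∣t : + 2 ∣ t) (t∣K : t ∣ K) (M⊥t : M ⊥ t)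
         (K+1⊥M : K + 1ℤ ⊥ M) (4<K : 4 ℕ.< ∣ K ∣) where

  private
    M≢0 : M ≢ 0ℤ
    M≢0 = ⊥even⇒≢0 2∣t M⊥t

    t≢0 : t ≢ 0ℤ
    t≢0 t≡0 = ℕ.n≮0 (subst (λ z → 4 ℕ.< ∣ z ∣) (0∣⇒≡0 (subst (_∣ K) t≡0 t∣K)) 4<K)

    K≢-2 : K ≢ - + 2
    K≢-2 K≡-2 with s≤s (s≤s ()) ← subst (λ z → 4 ℕ.< ∣ z ∣) K≡-2 4<K

    K≡small : ∀ {K} c → K + c ≡ 0ℤ → K ≡ - c
    K≡small {K} c eq = trans (rearrange K c) (trans (cong (_- c) eq) (ℤ.+-identityˡ (- c)))
      where
      rearrange : ∀ K c → K ≡ K + c - c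
      rearrange = solve-∀

    head₀ : ℤ
    head₀ = - (K + 1ℤ)

    head₀⊥t : head₀ ⊥ t
    head₀⊥t = ⊥-sym (⊥-neg (⊥-sym (⊥-mod (subst (_≡ 1ℤ [mod t ]) (ℤ.+-comm 1ℤ K) (mod-shift 1ℤ t∣K)) 1⊥)))

    head₀⊥M : head₀ ⊥ M
    head₀⊥M = ⊥-sym (⊥-neg (⊥-sym K+1⊥M))

  -- A single summand `- K` would be a multiple of `t`; two units `- (K + 1ℤ)` and 1 are the least
  -- possible, and with the four large summands they give the length 6.
  two : Completion K t M 1
  two = record
    { head = head₀
    ; tail = 1ℤ ∷ []
    ; head⊥t = head₀⊥t
    ; head≢1 = λ eq → K≢-2 (trans (recover K) (cong (λ z → - (z + 1ℤ)) eq))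
    ; total = total K
    ; pairwise = (⊥-one ∷ []) ∷ [] ∷ []
    ; nondegenerate = head₀⊥M ∷ 1⊥ ∷ []
    ; admissible = inj₁ 1⊥ ∷ []
    ; rigid = rigid
    }
    where
    recover : ∀ K → K ≡ - (- (K + 1ℤ) + 1ℤ)
    recover = solve-∀
    total : ∀ K → K + (- (K + 1ℤ) + (1ℤ + 0ℤ)) ≡ 0ℤ
    total = solve-∀
    expand : ∀ K b₀ b₁ b₂ → b₀ * K + (b₁ * - (K + 1ℤ) + (b₂ * 1ℤ + 0ℤ)) ≡ (b₂ - b₁) + K * (b₀ - b₁)
    expand = solve-∀
    rigid : Rigid (K ∷ head₀ ∷ 1ℤ ∷ [])
    rigid b signed eq = λ where
        Fin.zero → refl
        (Fin.suc Fin.zero) → sym b₀≡b₁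
        (Fin.suc (Fin.suc Fin.zero)) → trans b₂≡b₁ (sym b₀≡b₁)
      where
      b₀ = b Fin.zero
      b₁ = b (Fin.suc Fin.zero)
      b₂ = b (Fin.suc (Fin.suc Fin.zero))
      digits = digit K (b₀ - b₁) (trans (sym (expand K b₀ b₁ b₂)) eq)
        (ℕ.≤-<-trans (∣signed-signed∣≤2 (signed _) (signed _)) (ℕ.<-trans (ℕ.m≤m+n 3 1) 4<K))
      b₂≡b₁ : b₂ ≡ b₁
      b₂≡b₁ = ℤ.i-j≡0⇒i≡j b₂ b₁ (proj₁ digits)
      b₀≡b₁ : b₀ ≡ b₁
      b₀≡b₁ = ℤ.i-j≡0⇒i≡j b₀ b₁ (proj₂ digits)

  -- Three units modulo the even `t` are odd and cannot sum to the even `- K`, so one summand is 2.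
  -- The other two sum to `- (K + + 2)`, and `N - 1ℤ` is -1 modulo this divisor of `N`, which makes
  -- them coprime.
  three-from : ∀ N → t ∣ N → M ∣ N → K + + 2 ∣ N → 5 ℕ.+ (∣ K ∣ ℕ.* 2 ℕ.+ 4) ℕ.≤ ∣ N ∣ → Completion K t M 2
  three-from N t∣N M∣N K+2∣N H≤N = record
    { head = head₀ - N
    ; tail = + 2 ∷ N - 1ℤ ∷ []
    ; head⊥t = head⊥t
    ; head≢1 = head≢1
    ; total = total K N
    ; pairwise = (⊥-∣ 2∣t head⊥t ∷ head⊥N-1 ∷ []) ∷ (⊥-sym (N-1⊥ (∣-trans 2∣t t∣N)) ∷ []) ∷ [] ∷ []
    ; nondegenerate = ⊥-mod (mod-shift head₀ (∣m⇒∣-m M∣N)) head₀⊥M ∷ ⊥-sym (⊥-∣ 2∣t M⊥t) ∷ N-1⊥ M∣N ∷ []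
    ; admissible = inj₂ refl ∷ inj₁ (N-1⊥ t∣N) ∷ []
    ; rigid = rigid
    }
    where
    N-1⊥ : ∀ {m} → m ∣ N → N - 1ℤ ⊥ m
    N-1⊥ m∣N = ⊥-mod (subst (_≡ -1ℤ [mod _ ]) (ℤ.+-comm -1ℤ N) (mod-shift -1ℤ m∣N)) -1⊥

    head⊥t : head₀ - N ⊥ t
    head⊥t = ⊥-mod (mod-shift head₀ (∣m⇒∣-m t∣N)) head₀⊥t

    head⊥N-1 : head₀ - N ⊥ N - 1ℤ
    head⊥N-1 = ⊥-mod (-1ℤ , rearrange K N) (⊥-sym (⊥-neg (N-1⊥ K+2∣N)))
      where
      rearrange : ∀ K N → - (K + 1ℤ) - N ≡ - (K + + 2) + -1ℤ * (N - 1ℤ)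
      rearrange = solve-∀

    head≢1 : head₀ - N ≢ 1ℤ
    head≢1 eq = ℕ.<-irrefl refl (ℕ.≤-trans (s≤s ∣N∣≤) H≤N)
      where
      recover : ∀ K N → N ≡ - (K + + 2) + (1ℤ - (- (K + 1ℤ) - N))
      recover = solve-∀
      N≡ : N ≡ - (K + + 2)
      N≡ = trans (recover K N) (trans (cong (λ z → - (K + + 2) + (1ℤ - z)) eq) (ℤ.+-identityʳ _))
      open ℕ.≤-Reasoning
      ∣N∣≤ : ∣ N ∣ ℕ.≤ 4 ℕ.+ (∣ K ∣ ℕ.* 2 ℕ.+ 4)
      ∣N∣≤ = begin
        ∣ N ∣              ≡⟨ trans (cong ∣_∣ N≡) (ℤ.∣-i∣≡∣i∣ (K + + 2)) ⟩
        ∣ K + + 2 ∣        ≤⟨ ℤ.∣i+j∣≤∣i∣+∣j∣ K (+ 2) ⟩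
        ∣ K ∣ ℕ.+ 2        ≤⟨ ℕ.+-mono-≤ (ℕ.m≤m*n (∣ K ∣) 2) (ℕ.m≤m+n 2 2) ⟩
        ∣ K ∣ ℕ.* 2 ℕ.+ 4  ≤⟨ ℕ.m≤n+m _ 4 ⟩
        4 ℕ.+ (∣ K ∣ ℕ.* 2 ℕ.+ 4) ∎

    total : ∀ K N → K + (- (K + 1ℤ) - N + (+ 2 + (N - 1ℤ + 0ℤ))) ≡ 0ℤ
    total = solve-∀

    expand : ∀ K N b₀ b₁ b₂ b₃ →
      b₀ * K + (b₁ * (- (K + 1ℤ) - N) + (b₂ * + 2 + (b₃ * (N - 1ℤ) + 0ℤ))) ≡
      (((b₂ - b₁) + (b₂ - b₃)) + K * (b₀ - b₁)) + N * (b₃ - b₁)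
    expand = solve-∀

    rigid : Rigid (K ∷ head₀ - N ∷ + 2 ∷ N - 1ℤ ∷ [])
    rigid b signed eq = λ where
        Fin.zero → refl
        (Fin.suc Fin.zero) → sym b₀≡b₁
        (Fin.suc (Fin.suc Fin.zero)) → trans b₂≡b₁ (sym b₀≡b₁)
        (Fin.suc (Fin.suc (Fin.suc Fin.zero))) → trans b₃≡b₁ (sym b₀≡b₁)
      where
      b₀ = b Fin.zero
      b₁ = b (Fin.suc Fin.zero)
      b₂ = b (Fin.suc (Fin.suc Fin.zero))
      b₃ = b (Fin.suc (Fin.suc (Fin.suc Fin.zero)))

      -- Once base `N` has given `b₃ ≡ b₁`, this digit is twice `b₂ - b₁`.
      c = (b₂ - b₁) + (b₂ - b₃)

      ∣c∣≤4 : ∣ c ∣ ℕ.≤ 4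
      ∣c∣≤4 = ℕ.≤-trans (ℤ.∣i+j∣≤∣i∣+∣j∣ (b₂ - b₁) (b₂ - b₃))
        (ℕ.+-mono-≤ (∣signed-signed∣≤2 (signed _) (signed _)) (∣signed-signed∣≤2 (signed _) (signed _)))

      open ℕ.≤-Reasoning
      small : ∣ c + K * (b₀ - b₁) ∣ ℕ.< ∣ N ∣
      small = begin-strict
        ∣ c + K * (b₀ - b₁) ∣            ≤⟨ ℤ.∣i+j∣≤∣i∣+∣j∣ c _ ⟩
        ∣ c ∣ ℕ.+ ∣ K * (b₀ - b₁) ∣      ≡⟨ cong (∣ c ∣ ℕ.+_) (ℤ.abs-* K (b₀ - b₁)) ⟩
        ∣ c ∣ ℕ.+ ∣ K ∣ ℕ.* ∣ b₀ - b₁ ∣  ≤⟨ ℕ.+-mono-≤ ∣c∣≤4 (ℕ.*-monoʳ-≤ (∣ K ∣) (∣signed-signed∣≤2 (signed _) (signed _))) ⟩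
        4 ℕ.+ ∣ K ∣ ℕ.* 2                ≤⟨ ℕ.+-monoʳ-≤ 4 (ℕ.m≤m+n _ 4) ⟩
        4 ℕ.+ (∣ K ∣ ℕ.* 2 ℕ.+ 4)        <⟨ ℕ.n<1+n _ ⟩
        5 ℕ.+ (∣ K ∣ ℕ.* 2 ℕ.+ 4)        ≤⟨ H≤N ⟩
        ∣ N ∣                            ∎

      digits = digit N (b₃ - b₁) (trans (sym (expand K N b₀ b₁ b₂ b₃)) eq) small
      b₃≡b₁ : b₃ ≡ b₁
      b₃≡b₁ = ℤ.i-j≡0⇒i≡j b₃ b₁ (proj₂ digits)

      digits′ = digit K (b₀ - b₁) (proj₁ digits) (ℕ.≤-<-trans ∣c∣≤4 4<K)
      b₀≡b₁ : b₀ ≡ b₁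
      b₀≡b₁ = ℤ.i-j≡0⇒i≡j b₀ b₁ (proj₂ digits′)

      twice : ∀ b₁ b₂ → (b₂ - b₁) + (b₂ - b₁) ≡ + 2 * (b₂ - b₁)
      twice = solve-∀

      b₂≡b₁ : b₂ ≡ b₁
      b₂≡b₁ with ℤ.i*j≡0⇒i≡0∨j≡0 (+ 2)
                   (trans (sym (twice b₁ b₂)) (subst (λ z → (b₂ - b₁) + (b₂ - z) ≡ 0ℤ) b₃≡b₁ (proj₁ digits′)))
      ... | inj₂ b₂-b₁≡0 = ℤ.i-j≡0⇒i≡j b₂ b₁ b₂-b₁≡0

  three : Completion K t M 2
  three = three-from (P * + H)
    (∣m⇒∣m*n (+ H) (∣m⇒∣m*n (M * (K + + 2)) ∣-refl))
    (∣m⇒∣m*n (+ H) (∣n⇒∣m*n t (∣m⇒∣m*n (K + + 2) ∣-refl)))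
    (∣m⇒∣m*n (+ H) (∣n⇒∣m*n t (∣n⇒∣m*n M ∣-refl)))
    (≤∣*∣ (*≢0 t≢0 (*≢0 M≢0 K+2≢0)) H)
    where
    H = 5 ℕ.+ (∣ K ∣ ℕ.* 2 ℕ.+ 4)
    P = t * (M * (K + + 2))
    K+2≢0 : K + + 2 ≢ 0ℤ
    K+2≢0 eq = K≢-2 (K≡small (+ 2) eq)

  module Splitting {n} (C : Completion K t M n) where
    open Completion C

    private
      T = prodℤ (lookup tail)
      -- Serves both expansions: the digit in base `N` is at most the sum of absolute values plus 2,
      -- and `w` gets absolute value above 2.
      H = 3 ℕ.+ sumAbs (K ∷ head ∷ tail)

    -- The head h is split as (h − N) + (N − u) + u with u = 1 + N (h − N): modulo N these are
    -- h, −1 and 1, and the divisor h − 1 of N makes the first two coprime.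
    module Step (N : ℤ) (t∣N : t ∣ N) (M∣N : M ∣ N) (head-1∣N : head - 1ℤ ∣ N) (T∣N : T ∣ N)
             (H≤N : H ℕ.≤ ∣ N ∣) where

      w = head - N
      u = 1ℤ + N * w
      v = N - u

      tail∣N : Allᵥ (_∣ N) tail
      tail∣N = Allᵥ.map (λ e∣T → ∣-trans e∣T T∣N) (∣prodℤ tail)

      2<∣w∣ : 2 ℕ.< ∣ w ∣
      2<∣w∣ = ℕ.+-cancelʳ-≤ (∣ head ∣) 3 (∣ w ∣) (begin
        3 ℕ.+ ∣ head ∣       ≤⟨ ℕ.+-monoʳ-≤ 3 (ℕ.m≤n⇒m≤o+n (∣ K ∣) (ℕ.m≤m+n (∣ head ∣) (sumAbs tail))) ⟩
        H                    ≤⟨ H≤N ⟩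
        ∣ N ∣                ≡⟨ cong ∣_∣ (recover head N) ⟩
        ∣ head - w ∣         ≤⟨ ℤ.∣i-j∣≤∣i∣+∣j∣ head w ⟩
        ∣ head ∣ ℕ.+ ∣ w ∣   ≡⟨ ℕ.+-comm (∣ head ∣) (∣ w ∣) ⟩
        ∣ w ∣ ℕ.+ ∣ head ∣   ∎)
        where
        open ℕ.≤-Reasoning
        recover : ∀ h N → N ≡ h - (h - N)
        recover = solve-∀

      w⊥ : ∀ {m} → m ∣ N → head ⊥ m → w ⊥ m
      w⊥ m∣N = ⊥-mod (mod-shift head (∣m⇒∣-m m∣N))
      u⊥ : ∀ {m} → m ∣ N → u ⊥ m
      u⊥ m∣N = ⊥-mod (mod-shift 1ℤ (∣m⇒∣m*n w m∣N)) 1⊥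
      v⊥ : ∀ {m} → m ∣ N → v ⊥ m
      v⊥ m∣N = ⊥-mod (subst (_≡ -1ℤ [mod _ ]) (rearrange N w) (mod-shift -1ℤ (∣m⇒∣m*n (1ℤ - w) m∣N))) -1⊥
        where
        rearrange : ∀ N w → -1ℤ + N * (1ℤ - w) ≡ N - (1ℤ + N * w)
        rearrange = solve-∀

      u⊥w : u ⊥ w
      u⊥w = ⊥-mod (N , refl) 1⊥

      v⊥u : v ⊥ u
      v⊥u = ⊥-mod (-1ℤ , rearrange N u) (⊥-sym (u⊥ ∣-refl))
        where
        rearrange : ∀ N u → N - u ≡ N + -1ℤ * u
        rearrange = solve-∀

      -- Modulo `w` one has `N = head`, so `v` becomes `head - 1ℤ`; modulo `head - 1ℤ` in turn `w`
      -- is 1.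
      v⊥w : v ⊥ w
      v⊥w = ⊥-mod (- (1ℤ + N) , rearrange head N)
        (⊥-sym (w⊥ head-1∣N (⊥-mod (1ℤ , unit head) 1⊥)))
        where
        rearrange : ∀ h N → N - (1ℤ + N * (h - N)) ≡ (h - 1ℤ) + - (1ℤ + N) * (h - N)
        rearrange = solve-∀
        unit : ∀ h → h ≡ 1ℤ + 1ℤ * (h - 1ℤ)
        unit = solve-∀

      total′ : sumℤ (lookup (K ∷ w ∷ v ∷ u ∷ tail)) ≡ 0ℤ
      total′ = trans (rearrange K head N w (sumℤ (lookup tail))) total
        where
        rearrange : ∀ K h N w S → K + ((h - N) + (N - (1ℤ + N * w) + (1ℤ + N * w + S))) ≡ K + (h + S)
        rearrange = solve-∀

      expand : ∀ K h N w S b₀ b₁ b₂ b₃ →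
        b₀ * K + (b₁ * (h - N) + (b₂ * (N - (1ℤ + N * w)) + (b₃ * (1ℤ + N * w) + S))) ≡
        ((b₀ * K + (b₁ * h + S)) + (b₃ - b₂)) + N * ((b₂ - b₁) + w * (b₃ - b₂))
      expand = solve-∀

      -- The quotient in base `N`, expanded again in base `w`, makes the three new coefficients
      -- equal. The remainder is then a signed relation of the given completion, whose rigidity
      -- applies.
      rigid′ : Rigid (K ∷ w ∷ v ∷ u ∷ tail)
      rigid′ b signed eq = λ where
          Fin.zero → refl
          (Fin.suc Fin.zero) → b₁≡b₀
          (Fin.suc (Fin.suc Fin.zero)) → trans b₂≡b₁ b₁≡b₀
          (Fin.suc (Fin.suc (Fin.suc Fin.zero))) → trans b₃≡b₂ (trans b₂≡b₁ b₁≡b₀)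
          (Fin.suc (Fin.suc (Fin.suc (Fin.suc i)))) → constant (Fin.suc (Fin.suc i))
        where
        b₀ = b Fin.zero
        b₁ = b (Fin.suc Fin.zero)
        b₂ = b (Fin.suc (Fin.suc Fin.zero))
        b₃ = b (Fin.suc (Fin.suc (Fin.suc Fin.zero)))

        -- Forgets the positions of `v` and `u`; the coefficient of `w` becomes that of `head`.
        merge : Fin (2 ℕ.+ n) → Fin (4 ℕ.+ n)
        merge Fin.zero = Fin.zero
        merge (Fin.suc Fin.zero) = Fin.suc Fin.zero
        merge (Fin.suc (Fin.suc i)) = Fin.suc (Fin.suc (Fin.suc (Fin.suc i)))

        S = sumℤ (λ i → b (Fin.suc (Fin.suc (Fin.suc (Fin.suc i)))) * lookup tail i)
        c = b₀ * K + (b₁ * head + S)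

        small : ∣ c + (b₃ - b₂) ∣ ℕ.< ∣ N ∣
        small = begin-strict
          ∣ c + (b₃ - b₂) ∣                     ≤⟨ ℤ.∣i+j∣≤∣i∣+∣j∣ c (b₃ - b₂) ⟩
          ∣ c ∣ ℕ.+ ∣ b₃ - b₂ ∣                 ≤⟨ ℕ.+-mono-≤ (∣signedSum∣≤ (K ∷ head ∷ tail) {b ∘ merge} (signed ∘ merge)) (∣signed-signed∣≤2 (signed _) (signed _)) ⟩
          sumAbs (K ∷ head ∷ tail) ℕ.+ 2        ≡⟨ ℕ.+-comm _ 2 ⟩
          2 ℕ.+ sumAbs (K ∷ head ∷ tail)        <⟨ ℕ.n<1+n _ ⟩
          H                                     ≤⟨ H≤N ⟩
          ∣ N ∣                                 ∎
          where open ℕ.≤-Reasoning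

        digits = digit N ((b₂ - b₁) + w * (b₃ - b₂)) (trans (sym (expand K head N w S b₀ b₁ b₂ b₃)) eq) small
        digits′ = digit w (b₃ - b₂) (proj₂ digits) (ℕ.≤-<-trans (∣signed-signed∣≤2 (signed _) (signed _)) 2<∣w∣)

        b₂≡b₁ : b₂ ≡ b₁
        b₂≡b₁ = ℤ.i-j≡0⇒i≡j b₂ b₁ (proj₁ digits′)
        b₃≡b₂ : b₃ ≡ b₂
        b₃≡b₂ = ℤ.i-j≡0⇒i≡j b₃ b₂ (proj₂ digits′)

        c≡0 : c ≡ 0ℤ
        c≡0 = trans (sym (trans (cong (_+_ c) (proj₂ digits′)) (ℤ.+-identityʳ c))) (proj₁ digits)

        constant : ∀ i → b (merge i) ≡ b₀
        constant = rigid (b ∘ merge) (signed ∘ merge) c≡0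

        b₁≡b₀ : b₁ ≡ b₀
        b₁≡b₀ = constant (Fin.suc Fin.zero)

      split-by : Completion K t M (2 ℕ.+ n)
      split-by = record
        { head = w
        ; tail = v ∷ u ∷ tail
        ; head⊥t = w⊥ t∣N head⊥t
        ; head≢1 = λ w≡1 → ℕ.<⇒≱ (subst (λ z → 2 ℕ.< ∣ z ∣) w≡1 2<∣w∣) (s≤s z≤n)
        ; total = total′
        ; pairwise =
            (⊥-sym v⊥w ∷ ⊥-sym u⊥w ∷ Allᵥ.map (λ (e∣N , h⊥e) → w⊥ e∣N h⊥e) (Allᵥ.zip (tail∣N , AllPairs.head pairwise))) ∷
            (v⊥u ∷ Allᵥ.map v⊥ tail∣N) ∷
            Allᵥ.map u⊥ tail∣N ∷
            AllPairs.tail pairwise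
        ; nondegenerate = w⊥ M∣N (Allᵥ.head nondegenerate) ∷ v⊥ M∣N ∷ u⊥ M∣N ∷ Allᵥ.tail nondegenerate
        ; admissible = inj₁ (v⊥ t∣N) ∷ inj₁ (u⊥ t∣N) ∷ admissible
        ; rigid = rigid′
        }

    split : Completion K t M (2 ℕ.+ n)
    split = Step.split-by (P * + H)
      (∣m⇒∣m*n (+ H) (∣m⇒∣m*n (M * ((head - 1ℤ) * T)) ∣-refl))
      (∣m⇒∣m*n (+ H) (∣n⇒∣m*n t (∣m⇒∣m*n ((head - 1ℤ) * T) ∣-refl)))
      (∣m⇒∣m*n (+ H) (∣n⇒∣m*n t (∣n⇒∣m*n M (∣m⇒∣m*n T ∣-refl))))
      (∣m⇒∣m*n (+ H) (∣n⇒∣m*n t (∣n⇒∣m*n M (∣n⇒∣m*n (head - 1ℤ) ∣-refl))))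
      (≤∣*∣ (*≢0 t≢0 (*≢0 M≢0 (*≢0 (head≢1 ∘ ℤ.i-j≡0⇒i≡j head 1ℤ) (prodℤ≢0 tail≢0)))) H)
      where
      P = t * (M * ((head - 1ℤ) * T))
      nonzero : ∀ {e} → e ⊥ t ⊎ e ≡ + 2 → e ≢ 0ℤ
      nonzero (inj₁ e⊥t) = ⊥even⇒≢0 2∣t e⊥t
      nonzero (inj₂ refl) ()
      tail≢0 : Allᵥ (_≢ 0ℤ) tail
      tail≢0 = Allᵥ.map nonzero admissible

  -- Splitting adds two summands, so each parity needs its own start.
  completion : ∀ n → Completion K t M (suc n)
  completion zero = two
  completion (suc zero) = three
  completion (suc (suc n)) = Splitting.split (completion n)

-- Radicals

-- By induction `R` is `k * product ps`. A new prime cannot divide `product ps`, or it would occur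
-- in `ps`, so it divides `k`.
distinctPrimes⇒product∣ : ∀ {ps R} → Unique ps → All Prime ps → All (ℕ._∣ R) ps → product ps ℕ.∣ R
distinctPrimes⇒product∣ [] [] [] = ℕ.1∣ _
distinctPrimes⇒product∣ {p ∷ ps} (p∉ps ∷ unique) (p-prime ∷ primes) (p∣R ∷ ps∣R)
  with ℕ.divides k refl ← distinctPrimes⇒product∣ unique primes ps∣R
  with euclidsLemma k (product ps) p-prime p∣R
... | inj₁ p∣k = ℕ.*-monoˡ-∣ (product ps) p∣k
... | inj₂ p∣ps = contradiction refl (All.lookup p∉ps (factorisationHasAllPrimeFactors p-prime p∣ps primes))

infix 4 _≼_

-- Weaker than divisibility: powers and repeated factors cost nothing, which is how exponents
-- disappear from the radical bound.
_≼_ : ℕ → ℕ → Set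
N ≼ R = ∀ {p} → Prime p → p ℕ.∣ N → p ℕ.∣ R

rad≤ : ∀ {N R} .{{_ : ℕ.NonZero R}} → N ≼ R → rad N ℕ.≤ R
rad≤ {N} {R} N≼R = ℕ.∣⇒≤ (distinctPrimes⇒product∣ (Unique.filter⁺ P? (Unique.upTo⁺ (suc N)))
  (All.map proj₁ primeDivisors) (All.map (λ (p-prime , p∣N) → N≼R p-prime p∣N) primeDivisors))
  where
  P? = λ p → prime? p ×-dec p ℕ.∣? N
  primeDivisors : All (λ p → Prime p × p ℕ.∣ N) (filter P? (upTo (suc N)))
  primeDivisors = All.all-filter P? (upTo (suc N))

≼-refl : ∀ {N} → N ≼ N
≼-refl _ p∣N = p∣N

≼-* : ∀ {M N R S} → M ≼ R → N ≼ S → M ℕ.* N ≼ R ℕ.* S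
≼-* {M} {N} {R} {S} M≼R N≼S p-prime p∣MN with euclidsLemma M N p-prime p∣MN
... | inj₁ p∣M = ℕ.∣m⇒∣m*n S (M≼R p-prime p∣M)
... | inj₂ p∣N = ℕ.∣n⇒∣m*n R (N≼S p-prime p∣N)

≼-*-idem : ∀ {M N R} → M ≼ R → N ≼ R → M ℕ.* N ≼ R
≼-*-idem {M} {N} M≼R N≼R p-prime p∣MN with euclidsLemma M N p-prime p∣MN
... | inj₁ p∣M = M≼R p-prime p∣M
... | inj₂ p∣N = N≼R p-prime p∣N

^≼ : ∀ N k → N ℕ.^ k ≼ N
^≼ N zero p-prime p∣1 = contradiction (subst Prime (ℕ.∣1⇒≡1 p∣1) p-prime) ¬prime[1]
^≼ N (suc k) = ≼-*-idem ≼-refl (^≼ N k)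

^-distribʳ-* : ∀ k m n → (m ℕ.* n) ℕ.^ k ≡ m ℕ.^ k ℕ.* n ℕ.^ k
^-distribʳ-* zero m n = refl
^-distribʳ-* (suc k) m n = trans (cong (m ℕ.* n ℕ.*_) (^-distribʳ-* k m n)) (ℕ.[m*n]*[o*p]≡[m*o]*[n*p] m n (m ℕ.^ k) (n ℕ.^ k))

-- The strict inequality `4q < 5d` leaves one spare factor `X`, which absorbs the constant `H ^ q`.
power-gap : ∀ {r a H X} q d → r ℕ.≤ H ℕ.* X ℕ.^ 4 → X ℕ.^ 5 ℕ.≤ a → 4 ℕ.* q ℕ.< 5 ℕ.* d → H ℕ.^ q ℕ.< X → r ℕ.^ q ℕ.< a ℕ.^ d
power-gap {r} {a} {H} {X} q d r≤ ≤a 4q<5d H^q<X = begin-strict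
  r ℕ.^ q                  ≤⟨ ℕ.^-monoˡ-≤ q r≤ ⟩
  (H ℕ.* X ℕ.^ 4) ℕ.^ q        ≡⟨ ^-distribʳ-* q H (X ℕ.^ 4) ⟩
  H ℕ.^ q ℕ.* (X ℕ.^ 4) ℕ.^ q    ≡⟨ cong (H ℕ.^ q ℕ.*_) (ℕ.^-*-assoc X 4 q) ⟩
  H ℕ.^ q ℕ.* X ℕ.^ (4 ℕ.* q)    <⟨ ℕ.*-monoˡ-< (X ℕ.^ (4 ℕ.* q)) H^q<X ⟩
  X ℕ.^ suc (4 ℕ.* q)        ≤⟨ ℕ.^-monoʳ-≤ X 4q<5d ⟩
  X ℕ.^ (5 ℕ.* d)            ≡⟨ ℕ.^-*-assoc X 5 d ⟨
  (X ℕ.^ 5) ℕ.^ d            ≤⟨ ℕ.^-monoˡ-≤ d ≤a ⟩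
  a ℕ.^ d                  ∎
  where
  open ℕ.≤-Reasoning
  instance
    X≢0 : ℕ.NonZero X
    X≢0 = ℕ.>-nonZero (ℕ.≤-<-trans z≤n H^q<X)
    X^4q≢0 : ℕ.NonZero (X ℕ.^ (4 ℕ.* q))
    X^4q≢0 = ℕ.m^n≢0 X (4 ℕ.* q)

-- Large summands

fifth : ℤ → ℤ
fifth a = a * a * a * a * a

tuple : ∀ {n} → ℤ → ℤ → Vec ℤ n → Vec ℤ (4 ℕ.+ n)
tuple t x es =
  fifth (x + t) ∷
  - fifth (x - t) ∷
  (x * x - + 10 * (t * t * t)) * (x * x - + 10 * (t * t * t)) ∷
  - ((1ℤ + + 10 * t) * (x * x * x * x)) ∷
  es

defect : ℤ → ℤ
defect t = + 2 * (t * t * t * t * t) + + 100 * (t * t * t * t * t * t)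

-- The bases of the large summands at `x = 1`, without exponents and signs.
degenerate : ℤ → ℤ
degenerate t = (1ℤ + t) * ((1ℤ - t) * ((1ℤ - + 10 * (t * t * t)) * (1ℤ + + 10 * t)))

-- The least common multiple of 10, 99, 101, 103, 200002 and 100008, which contain all the
-- resultants that occur below.
constant-modulus : ℤ
constant-modulus = + 520196813916120

⊥-fifth : ∀ {a b} → a ⊥ b → a ⊥ fifth b
⊥-fifth p = ⊥-* (⊥-* (⊥-* (⊥-* p p) p) p) p

module Parameter (t : ℤ) (c∣t : constant-modulus ∣ t) (t≢0 : t ≢ 0ℤ) where

  2∣t : + 2 ∣ t
  2∣t = ∣-trans (divides (+ 260098406958060) refl) c∣t

  private
    9∣t : + 9 ∣ t
    9∣t = ∣-trans (divides (+ 57799645990680) refl) c∣t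
    10∣t : + 10 ∣ t
    10∣t = ∣-trans (divides (+ 52019681391612) refl) c∣t
    11∣t : + 11 ∣ t
    11∣t = ∣-trans (divides (+ 47290619446920) refl) c∣t
    99∣t : + 99 ∣ t
    99∣t = ∣-trans (divides (+ 5254513271880) refl) c∣t
    101∣t : + 101 ∣ t
    101∣t = ∣-trans (divides (+ 5150463504120) refl) c∣t
    103∣t : + 103 ∣ t
    103∣t = ∣-trans (divides (+ 5050454504040) refl) c∣t
    200002∣t : + 200002 ∣ t
    200002∣t = ∣-trans (divides (+ 2600958060) refl) c∣t
    100008∣t : + 100008 ∣ t
    100008∣t = ∣-trans (divides (+ 5201552015) refl) c∣t

  1+t⊥t : 1ℤ + t ⊥ t
  1+t⊥t = ⊥-mod (mod-shift 1ℤ ∣-refl) 1⊥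
  1-t⊥t : 1ℤ - t ⊥ t
  1-t⊥t = ⊥-mod (mod-shift 1ℤ (∣m⇒∣-m ∣-refl)) 1⊥
  1-10t³⊥t : 1ℤ - + 10 * (t * t * t) ⊥ t
  1-10t³⊥t = ⊥-mod (mod-shift 1ℤ (∣m⇒∣-m (∣n⇒∣m*n (+ 10) (∣n⇒∣m*n (t * t) ∣-refl)))) 1⊥
  1+10t⊥t : 1ℤ + + 10 * t ⊥ t
  1+10t⊥t = ⊥-mod (mod-shift 1ℤ (∣n⇒∣m*n (+ 10) ∣-refl)) 1⊥
  1-10t⊥t : 1ℤ - + 10 * t ⊥ t
  1-10t⊥t = ⊥-mod (mod-shift 1ℤ (∣m⇒∣-m (∣n⇒∣m*n (+ 10) ∣-refl))) 1⊥

  -- Eliminating `t` leaves 11, a divisor of `t`, and `1 + t` is a unit modulo `t`. The next lemmas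
  -- follow this pattern with 9, 11 and 101.
  1+t⊥1-10t : 1ℤ + t ⊥ 1ℤ - + 10 * t
  1+t⊥1-10t = ⊥-combination (+ 10) 1ℤ (certificate t) (⊥-∣ 11∣t 1+t⊥t)
    where
    certificate : ∀ t → + 10 * (1ℤ + t) + 1ℤ * (1ℤ - + 10 * t) ≡ + 11
    certificate = solve-∀
  1-t⊥1-10t : 1ℤ - t ⊥ 1ℤ - + 10 * t
  1-t⊥1-10t = ⊥-combination (+ 10) -1ℤ (certificate t) (⊥-∣ 9∣t 1-t⊥t)
    where
    certificate : ∀ t → + 10 * (1ℤ - t) + -1ℤ * (1ℤ - + 10 * t) ≡ + 9
    certificate = solve-∀
  1+t⊥1+10t : 1ℤ + t ⊥ 1ℤ + + 10 * t
  1+t⊥1+10t = ⊥-combination (+ 10) -1ℤ (certificate t) (⊥-∣ 9∣t 1+t⊥t)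
    where
    certificate : ∀ t → + 10 * (1ℤ + t) + -1ℤ * (1ℤ + + 10 * t) ≡ + 9
    certificate = solve-∀
  1-t⊥1+10t : 1ℤ - t ⊥ 1ℤ + + 10 * t
  1-t⊥1+10t = ⊥-combination (+ 10) 1ℤ (certificate t) (⊥-∣ 11∣t 1-t⊥t)
    where
    certificate : ∀ t → + 10 * (1ℤ - t) + 1ℤ * (1ℤ + + 10 * t) ≡ + 11
    certificate = solve-∀
  1-10t³⊥1+10t : 1ℤ - + 10 * (t * t * t) ⊥ 1ℤ + + 10 * t
  1-10t³⊥1+10t = ⊥-combination (+ 100) (+ 100 * (t * t) - + 10 * t + 1ℤ) (certificate t) (⊥-∣ 101∣t 1-10t³⊥t)
    where
    certificate : ∀ t → + 100 * (1ℤ - + 10 * (t * t * t)) + (+ 100 * (t * t) - + 10 * t + 1ℤ) * (1ℤ + + 10 * t) ≡ + 101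
    certificate = solve-∀

  t∣defect : t ∣ defect t
  t∣defect = ∣m∣n⇒∣m+n (∣n⇒∣m*n (+ 2) (∣n⇒∣m*n (t * t * t * t) ∣-refl)) (∣n⇒∣m*n (+ 100) (∣n⇒∣m*n (t * t * t * t * t) ∣-refl))

  degenerate⊥t : degenerate t ⊥ t
  degenerate⊥t = ⊥-sym (⊥-* (⊥-sym 1+t⊥t) (⊥-* (⊥-sym 1-t⊥t) (⊥-* (⊥-sym 1-10t³⊥t) (⊥-sym 1+10t⊥t))))

  -- The combinations come from reducing defect t + 1 at the roots of the factors of
  -- degenerate t; the constants they produce divide constant-modulus.
  defect+1⊥degenerate : defect t + 1ℤ ⊥ degenerate t
  defect+1⊥degenerate = ⊥-*
    (⊥-sym (⊥-combination (- (+ 98 * t - + 98 - + 98 * (t * t) + + 98 * (t * t * t) - + 98 * (t * t * t * t) + + 100 * (t * t * t * t * t))) 1ℤ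
      (at-1+t t) (⊥-∣ 99∣t 1+t⊥t)))
    (⊥-* (⊥-sym (⊥-combination (+ 102 + + 102 * t + + 102 * (t * t) + + 102 * (t * t * t) + + 102 * (t * t * t * t) + + 100 * (t * t * t * t * t)) 1ℤ
      (at-1-t t) (⊥-∣ 103∣t 1-t⊥t)))
    -- Where `kt³ = 1`, `defect t + 1` is `2(t⁵ + 1)`, and the second cofactor is
    -- `k⁵(t¹⁰ - t⁵ + 1)`; their product is `2k⁵(t¹⁵ + 1) = 2(1 + k⁵)`, that is 200002.
    (⊥-* (⊥-sym (⊥-combination
        ((k * k * k * k * k) + + 2 + (k * k * k * k) * (t * t) + ((k * k * k * k * k * k) + + 2 * k) * (t * t * t) - (k * k * k) * (t * t * t * t) - (k * k * k * k * k) * (t * t * t * t * t) + + 2 * (k * k) * (t * t * t * t * t * t) + (k * k * k * k) * (t * t * t * t * t * t * t))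
        ((k * k * k) * (t * t * t * t - k * (t * t) + k * k))
      (at-1-10t³ k t) (⊥-∣ 200002∣t 1-10t³⊥t)))
    (⊥-sym (⊥-combination
        (- (k * ((k * t) * (k * t) * (k * t) * (k * t) * (k * t) - (k * t) * (k * t) * (k * t) * (k * t) + (k * t) * (k * t) * (k * t) - (k * t) * (k * t) + (k * t) - 1ℤ) + + 2 * ((k * t) * (k * t) * (k * t) * (k * t) - (k * t) * (k * t) * (k * t) + (k * t) * (k * t) - (k * t) + 1ℤ)))
        (k * k * k * k * k)
      (at-1+10t k t) (⊥-∣ 100008∣t 1+10t⊥t)))))
    where
    k = + 10
    at-1+t : ∀ t → - (+ 98 * t - + 98 - + 98 * (t * t) + + 98 * (t * t * t) - + 98 * (t * t * t * t) + + 100 * (t * t * t * t * t)) * (1ℤ + t)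
      + 1ℤ * (+ 2 * (t * t * t * t * t) + + 100 * (t * t * t * t * t * t) + 1ℤ) ≡ + 99
    at-1+t = solve-∀
    at-1-t : ∀ t → (+ 102 + + 102 * t + + 102 * (t * t) + + 102 * (t * t * t) + + 102 * (t * t * t * t) + + 100 * (t * t * t * t * t)) * (1ℤ - t)
      + 1ℤ * (+ 2 * (t * t * t * t * t) + + 100 * (t * t * t * t * t * t) + 1ℤ) ≡ + 103
    at-1-t = solve-∀
    at-1-10t³ : ∀ k t →
      ((k * k * k * k * k) + + 2 + (k * k * k * k) * (t * t) + ((k * k * k * k * k * k) + + 2 * k) * (t * t * t) - (k * k * k) * (t * t * t * t) - (k * k * k * k * k) * (t * t * t * t * t) + + 2 * (k * k) * (t * t * t * t * t * t) + (k * k * k * k) * (t * t * t * t * t * t * t))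
        * (1ℤ - k * (t * t * t))
      + (k * k * k) * (t * t * t * t - k * (t * t) + k * k) * (+ 2 * (t * t * t * t * t) + k * k * (t * t * t * t * t * t) + 1ℤ) ≡ + 2 * (k * k * k * k * k) + + 2
    at-1-10t³ = solve-∀
    at-1+10t : ∀ k t →
      - (k * ((k * t) * (k * t) * (k * t) * (k * t) * (k * t) - (k * t) * (k * t) * (k * t) * (k * t) + (k * t) * (k * t) * (k * t) - (k * t) * (k * t) + (k * t) - 1ℤ) + + 2 * ((k * t) * (k * t) * (k * t) * (k * t) - (k * t) * (k * t) * (k * t) + (k * t) * (k * t) - (k * t) + 1ℤ))
        * (1ℤ + k * t)
      + (k * k * k * k * k) * (+ 2 * (t * t * t * t * t) + k * k * (t * t * t * t * t * t) + 1ℤ) ≡ (k * k * k * k * k) + k - + 2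
    at-1+10t = solve-∀

  1+10t≢0 : 1ℤ + + 10 * t ≢ 0ℤ
  1+10t≢0 eq with () ← proj₁ (digit (+ 10) {1ℤ} t eq (s≤s (s≤s z≤n)))

  -- A nonzero multiple of 10, since 10 divides `t`.
  4<∣defect∣ : 4 ℕ.< ∣ defect t ∣
  4<∣defect∣ = ℕ.≤-trans (ℕ.m≤m+n 5 5)
    (ℕ.∣⇒≤ {{≢-nonZero defect≢0}} (∣⇒∣ᵤ (∣-trans 10∣t t∣defect)))
    where
    factor : ∀ t → + 2 * (t * t * t * t * t) + + 100 * (t * t * t * t * t * t) ≡ t * t * t * t * t * (+ 2 + + 100 * t)
    factor = solve-∀
    2+100t≢0 : + 2 + + 100 * t ≢ 0ℤ
    2+100t≢0 eq with () ← proj₁ (digit (+ 100) {+ 2} t eq (ℕ.m≤m+n 3 97))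
    defect≢0 : defect t ≢ 0ℤ
    defect≢0 eq = *≢0 (*≢0 (*≢0 (*≢0 (*≢0 t≢0 t≢0) t≢0) t≢0) t≢0) 2+100t≢0 (trans (sym (factor t)) eq)

  completions : ∀ n → Completion (defect t) t (degenerate t) (suc n)
  completions = Completions.completion 2∣t t∣defect degenerate⊥t defect+1⊥degenerate 4<∣defect∣

-- Coprimality and vanishing sum of the tuple

module Member (t : ℤ) (c∣t : constant-modulus ∣ t) (t≢0 : t ≢ 0ℤ)
              {n} (C : Completion (defect t) t (degenerate t) n)
              (x D : ℤ) (x≡1 : x ≡ 1ℤ [mod D ])
              (t∣D : t ∣ D) (10∣D : + 10 ∣ D) (1-10t∣D : 1ℤ - + 10 * t ∣ D) (1+10t∣D : 1ℤ + + 10 * t ∣ D)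
              (es∣D : Allᵥ (_∣ D) (Completion.head C ∷ Completion.tail C)) where

  open Parameter t c∣t t≢0
  open Completion C

  es : Vec ℤ (suc n)
  es = head ∷ tail

  A = x + t
  B = x - t
  Q = x * x - + 10 * (t * t * t)

  private
    x≡1mod : ∀ {m} → m ∣ D → x ≡ 1ℤ [mod m ]
    x≡1mod (divides q refl) = let (k , eq) = x≡1 in k * q , trans eq (cong (_+_ 1ℤ) (sym (ℤ.*-assoc k q _)))

    x⊥ : ∀ {m} → m ∣ D → x ⊥ m
    x⊥ m∣D = ⊥-mod (x≡1mod m∣D) 1⊥

    -- Modulo a divisor of `D` the variable `x` may be set to 1, leaving a statement about `t`.
    A⊥ : ∀ {m} → m ∣ D → 1ℤ + t ⊥ m → A ⊥ m
    A⊥ {m} m∣D = let (k , eq) = x≡1mod m∣D in ⊥-mod (k , trans (cong (_+ t) eq) (rearrange k m t))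
      where
      rearrange : ∀ k m t → 1ℤ + k * m + t ≡ 1ℤ + t + k * m
      rearrange = solve-∀

    B⊥ : ∀ {m} → m ∣ D → 1ℤ - t ⊥ m → B ⊥ m
    B⊥ {m} m∣D = let (k , eq) = x≡1mod m∣D in ⊥-mod (k , trans (cong (_- t) eq) (rearrange k m t))
      where
      rearrange : ∀ k m t → 1ℤ + k * m - t ≡ 1ℤ - t + k * m
      rearrange = solve-∀

    Q⊥ : ∀ {m} → m ∣ D → 1ℤ - + 10 * (t * t * t) ⊥ m → Q ⊥ m
    Q⊥ {m} m∣D = let (k , eq) = x≡1mod m∣D in
      ⊥-mod (+ 2 * k + k * k * m , trans (cong (λ z → z * z - + 10 * (t * t * t)) eq) (rearrange k m (+ 10 * (t * t * t))))
      where
      rearrange : ∀ k m c → (1ℤ + k * m) * (1ℤ + k * m) - c ≡ 1ℤ - c + (+ 2 * k + k * k * m) * m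
      rearrange = solve-∀

  A⊥t : A ⊥ t
  A⊥t = A⊥ t∣D 1+t⊥t

  B⊥t : B ⊥ t
  B⊥t = B⊥ t∣D 1-t⊥t

  Q⊥t : Q ⊥ t
  Q⊥t = Q⊥ t∣D 1-10t³⊥t

  private
    A⊥B : A ⊥ B
    A⊥B = ⊥-mod (1ℤ , rearrange x t) (⊥-sym (⊥-* (⊥-∣ 2∣t B⊥t) B⊥t))
      where
      rearrange : ∀ x t → x + t ≡ + 2 * t + 1ℤ * (x - t)
      rearrange = solve-∀

    -- Modulo `A` one has `x = - t`, so `Q` becomes `t²(1 - 10t)`; this is where `1 - 10t` enters
    -- the modulus `D`.
    Q⊥A : Q ⊥ A
    Q⊥A = ⊥-mod (x - t , rearrange x t) (⊥-sym (⊥-* (⊥-* A⊥t A⊥t) (A⊥ 1-10t∣D 1+t⊥1-10t)))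
      where
      rearrange : ∀ x t → x * x - + 10 * (t * t * t) ≡ t * t * (1ℤ - + 10 * t) + (x - t) * (x + t)
      rearrange = solve-∀

    Q⊥B : Q ⊥ B
    Q⊥B = ⊥-mod (x + t , rearrange x t) (⊥-sym (⊥-* (⊥-* B⊥t B⊥t) (B⊥ 1-10t∣D 1-t⊥1-10t)))
      where
      rearrange : ∀ x t → x * x - + 10 * (t * t * t) ≡ t * t * (1ℤ - + 10 * t) + (x + t) * (x - t)
      rearrange = solve-∀

    ⊥-last : ∀ {a} → a ⊥ 1ℤ + + 10 * t → a ⊥ x → a ⊥ - ((1ℤ + + 10 * t) * (x * x * x * x))
    ⊥-last p q = ⊥-neg (⊥-* p (⊥-* (⊥-* (⊥-* q q) q) q))

    A⊥x : A ⊥ x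
    A⊥x = ⊥-mod (1ℤ , rearrange x t) (⊥-sym (x⊥ t∣D))
      where
      rearrange : ∀ x t → x + t ≡ t + 1ℤ * x
      rearrange = solve-∀

    B⊥x : B ⊥ x
    B⊥x = ⊥-mod (1ℤ , rearrange x t) (⊥-sym (⊥-neg (x⊥ t∣D)))
      where
      rearrange : ∀ x t → x - t ≡ - t + 1ℤ * x
      rearrange = solve-∀

    Q⊥x : Q ⊥ x
    Q⊥x = ⊥-mod (x , rearrange x t) (⊥-sym (⊥-neg (⊥-* (x⊥ 10∣D) (⊥-* (⊥-* (x⊥ t∣D) (x⊥ t∣D)) (x⊥ t∣D)))))
      where
      rearrange : ∀ x t → x * x - + 10 * (t * t * t) ≡ - (+ 10 * (t * t * t)) + x * x
      rearrange = solve-∀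

    last⊥ : ∀ {m} → 1ℤ + + 10 * t ⊥ m → x ⊥ m → - ((1ℤ + + 10 * t) * (x * x * x * x)) ⊥ m
    last⊥ p q = ⊥-sym (⊥-neg (⊥-* (⊥-sym p) (⊥-* (⊥-* (⊥-* q′ q′) q′) q′)))
      where q′ = ⊥-sym q

    fifth⊥ : ∀ {a m} → a ⊥ m → fifth a ⊥ m
    fifth⊥ = ⊥-sym ∘ ⊥-fifth ∘ ⊥-sym

    square⊥ : ∀ {a m} → a ⊥ m → a * a ⊥ m
    square⊥ p = ⊥-sym (⊥-* (⊥-sym p) (⊥-sym p))

    neg⊥ : ∀ {a m} → a ⊥ m → - a ⊥ m
    neg⊥ = ⊥-sym ∘ ⊥-neg ∘ ⊥-sym

    ⊥es : ∀ {a} → (∀ {e} → e ∣ D → e ⊥ degenerate t → a ⊥ e) → Allᵥ (a ⊥_) es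
    ⊥es f = Allᵥ.map (λ (e∣D , e⊥M) → f e∣D e⊥M) (Allᵥ.zip (es∣D , nondegenerate))

    module _ {e} (e⊥ : e ⊥ degenerate t) where
      1+t⊥e : 1ℤ + t ⊥ e
      1+t⊥e = ⊥-sym (⊥-∣ (∣m⇒∣m*n _ ∣-refl) e⊥)
      1-t⊥e : 1ℤ - t ⊥ e
      1-t⊥e = ⊥-sym (⊥-∣ (∣n⇒∣m*n (1ℤ + t) (∣m⇒∣m*n _ ∣-refl)) e⊥)
      1-10t³⊥e : 1ℤ - + 10 * (t * t * t) ⊥ e
      1-10t³⊥e = ⊥-sym (⊥-∣ (∣n⇒∣m*n (1ℤ + t) (∣n⇒∣m*n (1ℤ - t) (∣m⇒∣m*n _ ∣-refl))) e⊥)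
      1+10t⊥e : 1ℤ + + 10 * t ⊥ e
      1+10t⊥e = ⊥-sym (⊥-∣ (∣n⇒∣m*n (1ℤ + t) (∣n⇒∣m*n (1ℤ - t) (∣n⇒∣m*n (1ℤ - + 10 * (t * t * t)) ∣-refl))) e⊥)

  tuple-pairwise : AllPairs _⊥_ (tuple t x es)
  tuple-pairwise =
    (⊥-neg (⊥-fifth (fifth⊥ A⊥B)) ∷
     ⊥-* (fifth⊥ (⊥-sym Q⊥A)) (fifth⊥ (⊥-sym Q⊥A)) ∷
     ⊥-last (fifth⊥ (A⊥ 1+10t∣D 1+t⊥1+10t)) (fifth⊥ A⊥x) ∷
     ⊥es (λ e∣D e⊥ → fifth⊥ (A⊥ e∣D (1+t⊥e e⊥)))) ∷
    (neg⊥ (⊥-* (fifth⊥ (⊥-sym Q⊥B)) (fifth⊥ (⊥-sym Q⊥B))) ∷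
     neg⊥ (⊥-last (fifth⊥ (B⊥ 1+10t∣D 1-t⊥1+10t)) (fifth⊥ B⊥x)) ∷
     ⊥es (λ e∣D e⊥ → neg⊥ (fifth⊥ (B⊥ e∣D (1-t⊥e e⊥))))) ∷
    (⊥-last (square⊥ (Q⊥ 1+10t∣D 1-10t³⊥1+10t)) (square⊥ Q⊥x) ∷
     ⊥es (λ e∣D e⊥ → square⊥ (Q⊥ e∣D (1-10t³⊥e e⊥)))) ∷
    ⊥es (λ e∣D e⊥ → last⊥ (1+10t⊥e e⊥) (x⊥ e∣D)) ∷
    pairwise

  tuple-admissible : Allᵥ (λ e → e ⊥ t ⊎ e ≡ + 2) (tuple t x es)
  tuple-admissible =
    inj₁ (fifth⊥ A⊥t) ∷ inj₁ (neg⊥ (fifth⊥ B⊥t)) ∷ inj₁ (square⊥ Q⊥t) ∷ inj₁ (last⊥ 1+10t⊥t (x⊥ t∣D)) ∷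
    inj₁ head⊥t ∷ admissible

  tuple-total : SumZero (tuple t x es)
  tuple-total = trans (rearrange x t (sumℤ (lookup es))) total
    where
    rearrange : ∀ x t s →
      (x + t) * (x + t) * (x + t) * (x + t) * (x + t) +
      (- ((x - t) * (x - t) * (x - t) * (x - t) * (x - t)) +
      ((x * x - + 10 * (t * t * t)) * (x * x - + 10 * (t * t * t)) +
      (- ((1ℤ + + 10 * t) * (x * x * x * x)) + s))) ≡
      + 2 * (t * t * t * t * t) + + 100 * (t * t * t * t * t * t) + s
    rearrange = solve-∀

-- The coefficients of 1, x and x² in a signed sum over the tuple must vanish separately
-- once ∣ x ∣ exceeds this bound.
digitBound : ∀ {n} → ℤ → Vec ℤ n → ℕ
digitBound t es =
  (∣ t * t * t * t * t ∣ ℕ.+ (∣ t * t * t * t * t ∣ ℕ.+ (∣ + 100 * (t * t * t * t * t * t) ∣ ℕ.+ sumAbs es)))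
  ℕ.+ (∣ + 5 * (t * t * t * t) ∣ ℕ.* 2 ℕ.+ ∣ + 10 * (t * t * t) ∣ ℕ.* 4)

module Rigidity {t x : ℤ} (t≢0 : t ≢ 0ℤ) (1+10t≢0 : 1ℤ + + 10 * t ≢ 0ℤ)
         {n} {es : Vec ℤ n} (rigid : Rigid (defect t ∷ es)) (bound : digitBound t es ℕ.< ∣ x ∣) where

  private
    expand : ∀ x t b₁ b₂ b₃ b₄ s →
      b₁ * ((x + t) * (x + t) * (x + t) * (x + t) * (x + t)) +
      (b₂ * (- ((x - t) * (x - t) * (x - t) * (x - t) * (x - t))) +
      (b₃ * ((x * x - + 10 * (t * t * t)) * (x * x - + 10 * (t * t * t))) +
      (b₄ * (- ((1ℤ + + 10 * t) * (x * x * x * x))) + s))) ≡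
      (b₁ * (t * t * t * t * t) + (b₂ * (t * t * t * t * t) + (b₃ * (+ 100 * (t * t * t * t * t * t)) + s)))
      + x * (+ 5 * (t * t * t * t) * (b₁ - b₂)
      + x * (+ 10 * (t * t * t) * ((b₁ - b₃) + (b₂ - b₃))
      + x * (+ 10 * (t * t) * (b₁ - b₂)
      + x * (+ 5 * t * (b₁ + b₂) + b₃ - b₄ * (1ℤ + + 10 * t) + x * (b₁ - b₂)))))
    expand = solve-∀

    -- The `x³` and `x⁵` coefficients are multiples of `b₁ - b₂`. Once the first three coefficients
    -- agree only the `x⁴` term survives, so three digits suffice.
    collapse : ∀ x t b b₄ →
      + 10 * (t * t) * (b - b) + x * (+ 5 * t * (b + b) + b - b₄ * (1ℤ + + 10 * t) + x * (b - b)) ≡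
      x * ((1ℤ + + 10 * t) * (b - b₄))
    collapse = solve-∀

    collect : ∀ t b s →
      b * (t * t * t * t * t) + (b * (t * t * t * t * t) + (b * (+ 100 * (t * t * t * t * t * t)) + s)) ≡
      b * (+ 2 * (t * t * t * t * t) + + 100 * (t * t * t * t * t * t)) + s
    collect = solve-∀

    twice : ∀ y → y + y ≡ + 2 * y
    twice = solve-∀

    cancel : ∀ {a b} → a ≢ 0ℤ → a * b ≡ 0ℤ → b ≡ 0ℤ
    cancel {a} a≢0 ab≡0 with ℤ.i*j≡0⇒i≡0∨j≡0 a ab≡0
    ... | inj₁ a≡0 = contradiction a≡0 a≢0
    ... | inj₂ b≡0 = b≡0

    x≢0 : x ≢ 0ℤ
    x≢0 x≡0 = ℕ.n≮0 (subst (λ z → digitBound t es ℕ.< ∣ z ∣) x≡0 bound)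

    t³≢0 : t * t * t ≢ 0ℤ
    t³≢0 = *≢0 (*≢0 t≢0 t≢0) t≢0

  -- The digit at `x` gives `b₁ ≡ b₂`, the one at `x²` then `b₁ ≡ b₃`, the remaining quotient
  -- `b₁ ≡ b₄`. The constant digit turns into a relation of `defect t ∷ es`.
  tuple-rigid : Rigid (tuple t x es)
  tuple-rigid b signed eq = λ where
      Fin.zero → refl
      (Fin.suc Fin.zero) → sym b₁≡b₂
      (Fin.suc (Fin.suc Fin.zero)) → sym b₁≡b₃
      (Fin.suc (Fin.suc (Fin.suc Fin.zero))) → sym b₁≡b₄
      (Fin.suc (Fin.suc (Fin.suc (Fin.suc i)))) → constant (Fin.suc i)
    where
    b₁ = b Fin.zero
    b₂ = b (Fin.suc Fin.zero)
    b₃ = b (Fin.suc (Fin.suc Fin.zero))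
    b₄ = b (Fin.suc (Fin.suc (Fin.suc Fin.zero)))

    -- The common coefficient of the four large summands becomes that of `defect t`.
    merge : Fin (suc n) → Fin (4 ℕ.+ n)
    merge Fin.zero = Fin.zero
    merge (Fin.suc i) = Fin.suc (Fin.suc (Fin.suc (Fin.suc i)))

    s = sumℤ (λ i → b (Fin.suc (Fin.suc (Fin.suc (Fin.suc i)))) * lookup es i)

    c₀ = b₁ * (t * t * t * t * t) + (b₂ * (t * t * t * t * t) + (b₃ * (+ 100 * (t * t * t * t * t * t)) + s))
    c₁ = + 5 * (t * t * t * t) * (b₁ - b₂)
    c₂ = + 10 * (t * t * t) * ((b₁ - b₃) + (b₂ - b₃))

    ∣+∣≤ : ∀ i j {m n} → ∣ i ∣ ℕ.≤ m → ∣ j ∣ ℕ.≤ n → ∣ i + j ∣ ℕ.≤ m ℕ.+ n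
    ∣+∣≤ i j p q = ℕ.≤-trans (ℤ.∣i+j∣≤∣i∣+∣j∣ i j) (ℕ.+-mono-≤ p q)

    ∣*∣≤ : ∀ i {j m} → ∣ j ∣ ℕ.≤ m → ∣ i * j ∣ ℕ.≤ ∣ i ∣ ℕ.* m
    ∣*∣≤ i {j} p = ℕ.≤-trans (ℕ.≤-reflexive (ℤ.abs-* i j)) (ℕ.*-monoʳ-≤ (∣ i ∣) p)

    β₀ = ∣ t * t * t * t * t ∣ ℕ.+ (∣ t * t * t * t * t ∣ ℕ.+ (∣ + 100 * (t * t * t * t * t * t) ∣ ℕ.+ sumAbs es))
    β₁ = ∣ + 5 * (t * t * t * t) ∣ ℕ.* 2
    β₂ = ∣ + 10 * (t * t * t) ∣ ℕ.* 4

    ∣c₀∣< : ∣ c₀ ∣ ℕ.< ∣ x ∣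
    ∣c₀∣< = ℕ.≤-<-trans (ℕ.≤-trans
      (∣+∣≤ (b₁ * (t * t * t * t * t)) _ (∣signed*∣≤ (signed _) (t * t * t * t * t))
        (∣+∣≤ (b₂ * (t * t * t * t * t)) _ (∣signed*∣≤ (signed _) (t * t * t * t * t))
        (∣+∣≤ (b₃ * (+ 100 * (t * t * t * t * t * t))) s (∣signed*∣≤ (signed _) (+ 100 * (t * t * t * t * t * t)))
        (∣signedSum∣≤ es (λ i → signed (merge (Fin.suc i)))))))
      (ℕ.m≤m+n β₀ (β₁ ℕ.+ β₂))) bound

    ∣c₁∣< : ∣ c₁ ∣ ℕ.< ∣ x ∣
    ∣c₁∣< = ℕ.≤-<-trans (ℕ.≤-trans (∣*∣≤ (+ 5 * (t * t * t * t)) (∣signed-signed∣≤2 (signed _) (signed _)))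
      (ℕ.≤-trans (ℕ.m≤m+n β₁ β₂) (ℕ.m≤n+m (β₁ ℕ.+ β₂) β₀))) bound

    ∣c₂∣< : ∣ c₂ ∣ ℕ.< ∣ x ∣
    ∣c₂∣< = ℕ.≤-<-trans (ℕ.≤-trans
      (∣*∣≤ (+ 10 * (t * t * t)) (∣+∣≤ (b₁ - b₃) (b₂ - b₃) (∣signed-signed∣≤2 (signed _) (signed _)) (∣signed-signed∣≤2 (signed _) (signed _))))
      (ℕ.≤-trans (ℕ.m≤n+m β₂ β₁) (ℕ.m≤n+m (β₁ ℕ.+ β₂) β₀))) bound

    digits₀ = digit x {c₀} _ (trans (sym (expand x t b₁ b₂ b₃ b₄ s)) eq) ∣c₀∣<
    digits₁ = digit x {c₁} _ (proj₂ digits₀) ∣c₁∣<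
    digits₂ = digit x {c₂} _ (proj₂ digits₁) ∣c₂∣<

    b₁≡b₂ : b₁ ≡ b₂
    b₁≡b₂ = ℤ.i-j≡0⇒i≡j b₁ b₂ (cancel (*≢0 {+ 5} (λ ()) (*≢0 t³≢0 t≢0)) (proj₁ digits₁))

    b₁≡b₃ : b₁ ≡ b₃
    b₁≡b₃ = ℤ.i-j≡0⇒i≡j b₁ b₃ (cancel {+ 2} (λ ()) (trans (sym (twice (b₁ - b₃)))
      (subst (λ z → (b₁ - b₃) + (z - b₃) ≡ 0ℤ) (sym b₁≡b₂) (cancel (*≢0 {+ 10} (λ ()) t³≢0) (proj₁ digits₂)))))

    b₁≡b₄ : b₁ ≡ b₄
    b₁≡b₄ = ℤ.i-j≡0⇒i≡j b₁ b₄ (cancel 1+10t≢0 (cancel x≢0 (trans (sym (collapse x t b₁ b₄))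
      (subst₂ (λ y z → + 10 * (t * t) * (b₁ - y) + x * (+ 5 * t * (b₁ + y) + z - b₄ * (1ℤ + + 10 * t) + x * (b₁ - y)) ≡ 0ℤ)
        (sym b₁≡b₂) (sym b₁≡b₃) (proj₂ digits₂)))))

    c₀′≡0 : b₁ * defect t + s ≡ 0ℤ
    c₀′≡0 = trans (sym (collect t b₁ s))
      (subst₂ (λ y z → b₁ * (t * t * t * t * t) + (y * (t * t * t * t * t) + (z * (+ 100 * (t * t * t * t * t * t)) + s)) ≡ 0ℤ)
        (sym b₁≡b₂) (sym b₁≡b₃) (proj₁ digits₀))

    constant : ∀ i → b (merge i) ≡ b₁
    constant = rigid (b ∘ merge) (signed ∘ merge) c₀′≡0

-- Radical and maximum of the tuple

≼-abs* : ∀ {i j R S} → ∣ i ∣ ≼ R → ∣ j ∣ ≼ S → ∣ i * j ∣ ≼ R ℕ.* S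
≼-abs* {i} {j} {R} {S} p q = subst (_≼ R ℕ.* S) (sym (ℤ.abs-* i j)) (≼-* p q)

≼-abs*-idem : ∀ {i j R} → ∣ i ∣ ≼ R → ∣ j ∣ ≼ R → ∣ i * j ∣ ≼ R
≼-abs*-idem {i} {j} {R} p q = subst (_≼ R) (sym (ℤ.abs-* i j)) (≼-*-idem p q)

≼-abs-neg : ∀ {i R} → ∣ i ∣ ≼ R → ∣ - i ∣ ≼ R
≼-abs-neg {i} {R} = subst (_≼ R) (sym (ℤ.∣-i∣≡∣i∣ i))

fifth≼ : ∀ a → ∣ fifth a ∣ ≼ ∣ a ∣
fifth≼ a = ≼-abs*-idem {a * a * a * a} (≼-abs*-idem {a * a * a} (≼-abs*-idem {a * a} (≼-abs*-idem {a} {a} ≼-refl ≼-refl) ≼-refl) ≼-refl) ≼-refl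

-- For nonzero `x` of absolute value `X`, the two linear bases are at most `(1 + |t|)X` and the
-- quadratic one at most `(1 + |10t³|)X²`; the factor `x⁴` contributes only `p`.
radicalBound : ∀ {n} → ℤ → ℕ → Vec ℤ n → ℕ
radicalBound t p es = suc (∣ t ∣) ℕ.* (suc (∣ t ∣) ℕ.* (suc (∣ + 10 * (t * t * t) ∣) ℕ.* ((∣ 1ℤ + + 10 * t ∣ ℕ.* p) ℕ.* ∣ prodℤ (lookup es) ∣)))

module Radical (t x : ℤ) (p : ℕ) {n} (es : Vec ℤ n) (x≼p : ∣ x ∣ ≼ p)
               (A≢0 : x + t ≢ 0ℤ) (B≢0 : x - t ≢ 0ℤ) (Q≢0 : x * x - + 10 * (t * t * t) ≢ 0ℤ)
               (1+10t≢0 : 1ℤ + + 10 * t ≢ 0ℤ) (x≢0 : x ≢ 0ℤ) (p≢0 : ℕ.NonZero p) (es≢0 : prodℤ (lookup es) ≢ 0ℤ) where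

  private
    A = x + t
    B = x - t
    Q = x * x - + 10 * (t * t * t)
    c = + 10 * (t * t * t)
    E = prodℤ (lookup es)
    R = ∣ A ∣ ℕ.* (∣ B ∣ ℕ.* (∣ Q ∣ ℕ.* ((∣ 1ℤ + + 10 * t ∣ ℕ.* p) ℕ.* ∣ E ∣)))
    X = ∣ x ∣

    instance
      X≢0 : ℕ.NonZero X
      X≢0 = ≢-nonZero x≢0

    R≢0 : ℕ.NonZero R
    R≢0 = ℕ.m*n≢0 (∣ A ∣) _ {{≢-nonZero A≢0}} {{ℕ.m*n≢0 (∣ B ∣) _ {{≢-nonZero B≢0}} {{ℕ.m*n≢0 (∣ Q ∣) _ {{≢-nonZero Q≢0}}
      {{ℕ.m*n≢0 (∣ 1ℤ + + 10 * t ∣ ℕ.* p) _ {{ℕ.m*n≢0 (∣ 1ℤ + + 10 * t ∣) p {{≢-nonZero 1+10t≢0}} {{p≢0}}}} {{≢-nonZero es≢0}}}}}}}}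

    product≼R : ∣ prodℤ (lookup (tuple t x es)) ∣ ≼ R
    product≼R = ≼-abs* {fifth A} (fifth≼ A) (≼-abs* { - fifth B} (≼-abs-neg {fifth B} (fifth≼ B))
      (≼-abs* {Q * Q} (≼-abs*-idem {Q} {Q} ≼-refl ≼-refl)
      (≼-abs* { - ((1ℤ + + 10 * t) * (x * x * x * x))} {E} (≼-abs-neg {(1ℤ + + 10 * t) * (x * x * x * x)} (≼-abs* {1ℤ + + 10 * t} ≼-refl
        (≼-abs*-idem {x * x * x} (≼-abs*-idem {x * x} (≼-abs*-idem {x} {x} x≼p x≼p) x≼p) x≼p))) ≼-refl)))

    ∣A∣≤ : ∣ A ∣ ℕ.≤ suc (∣ t ∣) ℕ.* X
    ∣A∣≤ = ℕ.≤-trans (ℤ.∣i+j∣≤∣i∣+∣j∣ x t) (ℕ.+-monoʳ-≤ X (ℕ.m≤m*n (∣ t ∣) X))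

    ∣B∣≤ : ∣ B ∣ ℕ.≤ suc (∣ t ∣) ℕ.* X
    ∣B∣≤ = ℕ.≤-trans (ℤ.∣i-j∣≤∣i∣+∣j∣ x t) (ℕ.+-monoʳ-≤ X (ℕ.m≤m*n (∣ t ∣) X))

    ∣Q∣≤ : ∣ Q ∣ ℕ.≤ suc (∣ c ∣) ℕ.* (X ℕ.* X)
    ∣Q∣≤ = ℕ.≤-trans (ℤ.∣i-j∣≤∣i∣+∣j∣ (x * x) c)
      (ℕ.+-mono-≤ (ℕ.≤-reflexive (ℤ.abs-* x x)) (ℕ.m≤m*n (∣ c ∣) (X ℕ.* X) {{ℕ.m*n≢0 X X}}))

    regroup : ∀ a c e X → a ℕ.* X ℕ.* (a ℕ.* X ℕ.* (c ℕ.* (X ℕ.* X) ℕ.* e)) ≡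
      a ℕ.* (a ℕ.* (c ℕ.* e)) ℕ.* (X ℕ.* (X ℕ.* (X ℕ.* (X ℕ.* 1))))
    regroup = ℕ.solve-∀

  radProd≤ : radProd (tuple t x es) ℕ.≤ radicalBound t p es ℕ.* X ℕ.^ 4
  radProd≤ = ℕ.≤-trans (rad≤ {{R≢0}} product≼R) (ℕ.≤-trans
    (ℕ.*-mono-≤ ∣A∣≤ (ℕ.*-mono-≤ ∣B∣≤ (ℕ.*-monoˡ-≤ ((∣ 1ℤ + + 10 * t ∣ ℕ.* p) ℕ.* ∣ E ∣) ∣Q∣≤)))
    (ℕ.≤-reflexive (regroup (suc (∣ t ∣)) (suc (∣ c ∣)) ((∣ 1ℤ + + 10 * t ∣ ℕ.* p) ℕ.* ∣ E ∣) X)))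

≤maxAbs : ∀ {n} T X (es : Vec ℤ n) → X ℕ.^ 5 ℕ.≤ maxAbs (tuple (+ T) (+ X) es)
≤maxAbs T X es = ℕ.≤-trans (begin
  X ℕ.^ 5                  ≤⟨ ℕ.^-monoˡ-≤ 5 (ℕ.m≤m+n X T) ⟩
  Y ℕ.^ 5                  ≡⟨ regroup Y ⟩
  Y ℕ.* Y ℕ.* Y ℕ.* Y ℕ.* Y ≡⟨ abs-fifth (+ Y) ⟨
  ∣ fifth (+ Y) ∣          ∎) (ℕ.m≤m⊔n _ _)
  where
  open ℕ.≤-Reasoning
  Y = X ℕ.+ T
  regroup : ∀ Y → Y ℕ.* (Y ℕ.* (Y ℕ.* (Y ℕ.* (Y ℕ.* 1)))) ≡ Y ℕ.* Y ℕ.* Y ℕ.* Y ℕ.* Y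
  regroup = ℕ.solve-∀
  abs-fifth : ∀ a → ∣ fifth a ∣ ≡ ∣ a ∣ ℕ.* ∣ a ∣ ℕ.* ∣ a ∣ ℕ.* ∣ a ∣ ℕ.* ∣ a ∣
  abs-fifth a = trans (ℤ.abs-* (a * a * a * a) a) (cong (ℕ._* ∣ a ∣)
    (trans (ℤ.abs-* (a * a * a) a) (cong (ℕ._* ∣ a ∣)
    (trans (ℤ.abs-* (a * a) a) (cong (ℕ._* ∣ a ∣) (ℤ.abs-* a a))))))

-- Choice of parameters and conclusion

n<b^n : ∀ {b} → 1 ℕ.< b → ∀ n → n ℕ.< b ℕ.^ n
n<b^n 1<b zero = ℕ.≤-refl
n<b^n {b} 1<b (suc n) = ℕ.≤-<-trans (n<b^n 1<b n)
  (ℕ.^-monoʳ-< b 1<b {n} (ℕ.n<1+n n))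

suc^≡1 : ∀ d m → + (suc d ℕ.^ m) ≡ 1ℤ [mod + d ]
suc^≡1 d zero = 0ℤ , refl
suc^≡1 d (suc m) with k , eq ← suc^≡1 d m =
  1ℤ + k + k * + d ,
  trans (ℤ.pos-* (suc d) (suc d ℕ.^ m)) (trans (cong (+ suc d *_) eq) (rearrange k (+ d)))
  where
  rearrange : ∀ k d → (1ℤ + d) * (1ℤ + k * d) ≡ 1ℤ + (1ℤ + k + k * d) * d
  rearrange = solve-∀

sumMaxAbs : ∀ {n} → List (Vec ℤ n) → ℕ
sumMaxAbs [] = 0
sumMaxAbs (a ∷ S) = maxAbs a ℕ.+ sumMaxAbs S

maxAbs≤sumMaxAbs : ∀ {n} {a : Vec ℤ n} {S} → a ∈ S → maxAbs a ℕ.≤ sumMaxAbs S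
maxAbs≤sumMaxAbs {a = a} (here refl) = ℕ.m≤m+n (maxAbs a) _
maxAbs≤sumMaxAbs {S = b ∷ S} (there a∈S) = ℕ.m≤n⇒m≤o+n (maxAbs b) (maxAbs≤sumMaxAbs a∈S)

module Construction (F : List ℕ) (3≤F : All (3 ℕ.≤_) F) (k : ℕ) where

  T : ℕ
  T = 520196813916120 ℕ.* product F

  t : ℤ
  t = + T

  c∣t : constant-modulus ∣ t
  c∣t = ∣ᵤ⇒∣ (ℕ.m∣m*n (product F))

  t≢0 : t ≢ 0ℤ
  t≢0 eq = ℕ.≢-nonZero⁻¹ T {{ℕ.m*n≢0 520196813916120 (product F) {{_}} {{product≢0 (All.map (λ 3≤f → ℕ.>-nonZero (ℕ.≤-trans (s≤s z≤n) 3≤f)) 3≤F)}}}} (cong ∣_∣ eq)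

  open Parameter t c∣t t≢0

  C : Completion (defect t) t (degenerate t) (suc k)
  C = completions k

  open Completion C using (head; tail; head⊥t; admissible)

  es : Vec ℤ (2 ℕ.+ k)
  es = head ∷ tail

  admissible⇒≢0 : ∀ {e} → e ⊥ t ⊎ e ≡ + 2 → e ≢ 0ℤ
  admissible⇒≢0 (inj₁ e⊥t) = ⊥even⇒≢0 2∣t e⊥t
  admissible⇒≢0 (inj₂ refl) ()

  es≢0 : prodℤ (lookup es) ≢ 0ℤ
  es≢0 = prodℤ≢0 (⊥even⇒≢0 2∣t head⊥t ∷ Allᵥ.map admissible⇒≢0 admissible)

  D : ℤ
  D = t * (+ 10 * ((1ℤ - + 10 * t) * ((1ℤ + + 10 * t) * prodℤ (lookup es))))

  D≢0 : D ≢ 0ℤ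
  D≢0 = *≢0 t≢0 (*≢0 {+ 10} (λ ()) (*≢0 (⊥even⇒≢0 2∣t 1-10t⊥t) (*≢0 1+10t≢0 es≢0)))

  -- Every power of p is 1 modulo D, and all of them have the same radical.
  p : ℕ
  p = suc (∣ D ∣)

  1<p : 1 ℕ.< p
  1<p = s≤s (ℕ.n≢0⇒n>0 (D≢0 ∘ ℤ.∣i∣≡0⇒i≡0))

  ∣D⇒∣∣D∣ : ∀ {m} → m ∣ D → m ∣ + ∣ D ∣
  ∣D⇒∣∣D∣ m∣D = ∣-trans m∣D (∣ᵤ⇒∣ ℕ.∣-refl)

  -- Every `f` in `F` divides `t`, so a unit modulo `t` divisible by `f` would force `f` to be 1.
  notMultiple : ∀ {f e} → f ∈ F → e ⊥ t ⊎ e ≡ + 2 → ¬ (f ℕ.∣ ∣ e ∣)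
  notMultiple {f} f∈F (inj₁ e⊥t) f∣e = ℕ.<⇒≱ (All.lookup 3≤F f∈F)
    (ℕ.≤-trans (ℕ.≤-reflexive (⊥⇒coprime e⊥t f∣e (ℕ.∣n⇒∣m*n 520196813916120 (∈⇒∣product f∈F)))) (s≤s z≤n))
  notMultiple f∈F (inj₂ refl) f∣2 = ℕ.<⇒≱ (All.lookup 3≤F f∈F) (ℕ.∣⇒≤ f∣2)

  module _ (m : ℕ) where
    X : ℕ
    X = p ℕ.^ m

    member : Vec ℤ (6 ℕ.+ k)
    member = tuple t (+ X) es

    open Member t c∣t t≢0 C (+ X) (+ ∣ D ∣) (suc^≡1 (∣ D ∣) m)
      (∣D⇒∣∣D∣ (∣m⇒∣m*n _ ∣-refl))
      (∣D⇒∣∣D∣ (∣n⇒∣m*n t (∣m⇒∣m*n _ ∣-refl)))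
      (∣D⇒∣∣D∣ (∣n⇒∣m*n t (∣n⇒∣m*n (+ 10) (∣m⇒∣m*n _ ∣-refl))))
      (∣D⇒∣∣D∣ (∣n⇒∣m*n t (∣n⇒∣m*n (+ 10) (∣n⇒∣m*n (1ℤ - + 10 * t) (∣m⇒∣m*n _ ∣-refl)))))
      (Allᵥ.map (λ e∣E → ∣D⇒∣∣D∣ (∣n⇒∣m*n t (∣n⇒∣m*n (+ 10) (∣n⇒∣m*n (1ℤ - + 10 * t) (∣n⇒∣m*n (1ℤ + + 10 * t) e∣E))))) (∣prodℤ es))
      using (tuple-pairwise; tuple-admissible; tuple-total; A⊥t; B⊥t; Q⊥t)

    member∈U : digitBound t es ℕ.< X → InU F (6 ℕ.+ k) member
    member∈U bound =
      allPairs⇒pairwiseCoprime {a = member} tuple-pairwise ,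
      tuple-total ,
      rigid⇒¬vanishingSubsum {a = member} (Rigidity.tuple-rigid {t} {+ X} t≢0 1+10t≢0 {es = es} (Completion.rigid C) bound) ,
      λ f f∈F i → notMultiple f∈F (lookup⁺ tuple-admissible i)

    member-radProd≤ : radProd member ℕ.≤ radicalBound t p es ℕ.* X ℕ.^ 4
    member-radProd≤ = Radical.radProd≤ t (+ X) p es (^≼ p m)
      (⊥even⇒≢0 2∣t A⊥t) (⊥even⇒≢0 2∣t B⊥t) (⊥even⇒≢0 2∣t Q⊥t) 1+10t≢0
      (λ eq → ℕ.≢-nonZero⁻¹ X {{ℕ.m^n≢0 p m}} (cong ∣_∣ eq)) _ es≢0

  quality : QualityLimsupAtLeast5/4 (InU F (6 ℕ.+ k))
  quality q d _ 4q<5d S = member m , member∈U m bound<X , member∉S , power-gap q d (member-radProd≤ m) (≤maxAbs T (X m) es) 4q<5d H^q<X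
    where
    H^q = radicalBound t p es ℕ.^ q
    -- Since `p ^ m` exceeds `m`, one exponent secures rigidity, absorbs the radical constant and
    -- surpasses every entry in `S`.
    m = digitBound t es ℕ.+ (H^q ℕ.+ sumMaxAbs S)

    m<X : m ℕ.< X m
    m<X = n<b^n 1<p m

    bound<X : digitBound t es ℕ.< X m
    bound<X = ℕ.≤-<-trans (ℕ.m≤m+n _ _) m<X

    H^q<X : H^q ℕ.< X m
    H^q<X = ℕ.≤-<-trans (ℕ.≤-trans (ℕ.m≤m+n H^q _) (ℕ.m≤n+m _ (digitBound t es))) m<X

    member∉S : ¬ (member m ∈ S)
    member∉S member∈S = ℕ.<⇒≱ m<X (ℕ.≤-trans (ℕ.m≤m*n (X m) (X m ℕ.^ 4) {{ℕ.m^n≢0 (X m) 4 {{ℕ.m^n≢0 p m}}}})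
      (ℕ.≤-trans (≤maxAbs T (X m) es) (ℕ.≤-trans (maxAbs≤sumMaxAbs member∈S)
      (ℕ.≤-trans (ℕ.m≤n+m _ H^q) (ℕ.m≤n+m _ (digitBound t es))))))

vanishingSubsum-mono : ∀ {n} {a : Vec ℤ n} → VanishingSubsum InZeroOne a → VanishingSubsum InMinusZeroOne a
vanishingSubsum-mono (b , zeroOne , rest) = b , inj₂ ∘ zeroOne , rest

theorem1p13 : ((n : ℕ) → 6 ≤ n → (F : List ℕ) → All (3 ≤_) F →
    QualityLimsupAtLeast5/4 (InU F n))
    × ((n : ℕ) → 6 ≤ n → QualityLimsupAtLeast5/4 (InR n))
theorem1p13 = U-quality , R-quality
  where
  U-quality : (n : ℕ) → 6 ≤ n → (F : List ℕ) → All (3 ≤_) F → QualityLimsupAtLeast5/4 (InU F n)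
  U-quality n 6≤n F 3≤F with k , refl ← ℕ.m≤n⇒∃[o]m+o≡n 6≤n = Construction.quality F 3≤F k

  R-quality : (n : ℕ) → 6 ≤ n → QualityLimsupAtLeast5/4 (InR n)
  R-quality n 6≤n q d 0<d 4q<5d S
    with a , (coprime , total , nonvanishing , _) , a∉S , above ← U-quality n 6≤n [] [] q d 0<d 4q<5d S =
    a , (total , nonvanishing ∘ vanishingSubsum-mono {a = a} , coprime) , a∉S , above
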